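{- Let $B_k$ ($k\ge2$) be a generalized Bethe tree with parameters $n_1,\dots,n_k$ and $d_1,\dots,d_k$, let $\alpha\in[0,1)$ and $\beta=1-\alpha$. Let $T_k$ be the $k\times k$ symmetric tridiagonal matrix with diagonal entries $\alpha,\ \alpha d_2,\ \dots,\ \alpha d_k$, with $(s-1,s)$ and $(s,s-1)$ entries $\beta\sqrt{d_s-1}$ for $s=2,\dots,k-1$, and with $(k-1,k)$ and $(k,k-1)$ entries $\beta\sqrt{d_k}$; let $T_j$ be its $j\times j$ leading principal submatrix ($j=1,\dots,k$). Then: (1) as a multiset, the spectrum of $A_\alpha(B_k)$ is obtained by taking each eigenvalue of $T_j$ with multiplicity $n_j-n_{j+1}$ for $1\le j\le k-1$, and each eigenvalue of $T_k$ with multiplicity $1$, and forming the multiset union (multiplicities of equal eigenvalues arising from different $T_j$ being added); (2) the largest eigenvalue of $T_k$ equals the largest eigenvalue of $A_\alpha(B_k)$.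
   Context: For a graph $G$, $A(G)$ is the adjacency matrix, $D(G)$ the diagonal degree matrix, and $A_\alpha(G)=\alpha D(G)+(1-\alpha)A(G)$. In a rooted tree, the level of a vertex is its distance to the root plus one. A generalized Bethe tree $B_k$ is a rooted tree with $k$ levels in which all vertices at the same level have the same degree. For $j\in\{1,\dots,k\}$, $n_{k-j+1}$ denotes the number of vertices at level $j$ and $d_{k-j+1}$ their common degree (so index $1$ refers to the deepest level and index $k$ to the root; $d_1=1$, $n_k=1$). -}

module Defs where

open import Level using (Level; 0ℓ) renaming (suc to lsuc)
open import Algebra.Bundles using (CommutativeRing)
import Algebra.Properties.Group as GroupProperties
import Algebra.Properties.Semiring.Mult as Mult
import Algebra.Properties.Semiring.Sum as Sum
import Algebra.Solver.Ring.NaturalCoefficients.Default as Solver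
open import Data.Bool.Base using (if_then_else_)
open import Data.Empty using (⊥; ⊥-elim)
open import Data.Fin.Base using (Fin; toℕ; inject≤)
import Data.Fin.Properties as Fin
open import Data.List.Base using (List; []; _∷_; length; filter; allFin)
open import Data.List.Relation.Unary.Unique.Propositional using (Unique)
open import Data.Nat.Base as ℕ using (ℕ; zero; suc; _∸_)
import Data.Nat.Properties as ℕ
open import Data.Product.Base using (∃; _×_; _,_; proj₁; proj₂)
open import Data.Sum.Base using (inj₁; inj₂)
open import Data.Vec.Functional using (Vector)
open import Relation.Binary.Construct.Closure.ReflexiveTransitive using (Star; ε; _◅_)
open import Relation.Binary.Core using (Rel)
import Relation.Binary.Definitions as B
import Relation.Binary.Construct.NonStrictToStrict as NonStrictToStrict
open import Relation.Binary.PropositionalEquality.Core as ≡ using (_≡_)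
open import Relation.Binary.Structures using (IsDecTotalOrder)
open import Relation.Nullary.Decidable using (yes; no; does)
open import Relation.Nullary.Negation using (¬_)
import Relation.Unary as U

-- The real numbers, as a Dedekind-complete ordered field (unique up to
-- isomorphism).  The reading is classical: the order is decidable.
record Reals (ℓ : Level) : Set (lsuc ℓ) where
  field
    commutativeRing : CommutativeRing ℓ ℓ

  open CommutativeRing commutativeRing public

  infix 4 _≤_ _<_
  field
    _≤_             : Rel Carrier ℓ
    isDecTotalOrder : IsDecTotalOrder _≈_ _≤_
    0≉1             : ¬ (0# ≈ 1#)
    inverse         : ∀ x → ¬ (x ≈ 0#) → ∃ λ y → x * y ≈ 1#
    +-monoʳ-≤       : ∀ z {x y} → x ≤ y → z + x ≤ z + y
    *-nonneg        : ∀ {x y} → 0# ≤ x → 0# ≤ y → 0# ≤ x * y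

  IsUpperBound : U.Pred Carrier ℓ → Carrier → Set ℓ
  IsUpperBound P b = ∀ x → P x → x ≤ b

  IsSupremum : U.Pred Carrier ℓ → Carrier → Set ℓ
  IsSupremum P s = IsUpperBound P s × (∀ b → IsUpperBound P b → s ≤ b)

  field
    completeness : ∀ P → ∃ P → ∃ (IsUpperBound P) → ∃ (IsSupremum P)

  _<_ : Rel Carrier ℓ
  _<_ = NonStrictToStrict._<_ _≈_ _≤_

  open Mult semiring public using () renaming (_×_ to _×ᴿ_)

  fromℕ : ℕ → Carrier
  fromℕ n = n ×ᴿ 1#

module SquareRoot {ℓ} (R : Reals ℓ) where
  open Reals R
  open IsDecTotalOrder isDecTotalOrder
    using (_≟_; total; antisym; ≤-respʳ-≈; ≤-respˡ-≈)
    renaming (trans to ≤-trans; reflexive to ≤-reflexive)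
  open Solver commutativeSemiring using (solve; _:+_; _:*_; _:=_; con)
  open GroupProperties +-group using () renaming (∙-cancelˡ to +-cancelˡ)

  IsSqrt : Carrier → Carrier → Set ℓ
  IsSqrt a r = 0# ≤ r × r * r ≈ a

  private
    x≤x+d : ∀ x {d} → 0# ≤ d → x ≤ x + d
    x≤x+d x 0≤d = ≤-respˡ-≈ (+-identityʳ x) (+-monoʳ-≤ x 0≤d)

    +-nonneg : ∀ {x y} → 0# ≤ x → 0# ≤ y → 0# ≤ x + y
    +-nonneg {x} 0≤x 0≤y = ≤-trans 0≤x (x≤x+d x 0≤y)

    +-cancelˡ-≤ : ∀ z {x y} → z + x ≤ z + y → x ≤ y
    +-cancelˡ-≤ z z+x≤z+y =
      ≤-respˡ-≈ (cancel _) (≤-respʳ-≈ (cancel _) (+-monoʳ-≤ (- z) z+x≤z+y))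
      where
      cancel : ∀ x → - z + (z + x) ≈ x
      cancel x = trans (sym (+-assoc _ _ _)) (trans (+-congʳ (-‿inverseˡ z)) (+-identityˡ x))

    x+d≤x⇒d≤0 : ∀ x {d} → x + d ≤ x → d ≤ 0#
    x+d≤x⇒d≤0 x x+d≤x = +-cancelˡ-≤ x (≤-respʳ-≈ (sym (+-identityʳ x)) x+d≤x)

    difference : ∀ {x y} → x ≤ y → ∃ λ d → 0# ≤ d × x + d ≈ y
    difference {x} {y} x≤y = - x + y , ≤-respˡ-≈ (-‿inverseˡ x) (+-monoʳ-≤ (- x) x≤y) ,
      trans (sym (+-assoc _ _ _)) (trans (+-congʳ (-‿inverseʳ x)) (+-identityˡ y))

    square-nonneg : ∀ x → 0# ≤ x * x
    square-nonneg x with total 0# x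
    ... | inj₁ 0≤x = *-nonneg 0≤x 0≤x
    ... | inj₂ x≤0 with difference x≤0
    ...   | d , 0≤d , x+d≈0 = ≤-respʳ-≈ (+-cancelˡ (x * d) _ _ d²≈x²) (*-nonneg 0≤d 0≤d)
      where
      d²≈x² : x * d + d * d ≈ x * d + x * x
      d²≈x² = begin
        x * d + d * d  ≈⟨ distribʳ d x d ⟨
        (x + d) * d    ≈⟨ *-congʳ x+d≈0 ⟩
        0# * d         ≈⟨ zeroˡ d ⟩
        0#             ≈⟨ zeroʳ x ⟨
        x * 0#         ≈⟨ *-congˡ x+d≈0 ⟨
        x * (x + d)    ≈⟨ solve 2 (λ x d → x :* (x :+ d) := x :* d :+ x :* x) refl x d ⟩
        x * d + x * x  ∎
        where open import Relation.Binary.Reasoning.Setoid setoid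

    0≤1 : 0# ≤ 1#
    0≤1 = ≤-respʳ-≈ (*-identityˡ 1#) (square-nonneg 1#)

    square-mono : ∀ {x y} → 0# ≤ x → x ≤ y → x * x ≤ y * y
    square-mono {x} {y} 0≤x x≤y with difference x≤y
    ... | d , 0≤d , x+d≈y = ≤-respʳ-≈
      (trans (solve 2 (λ x d → x :* x :+ (d :* (x :+ x) :+ d :* d) := (x :+ d) :* (x :+ d)) refl x d)
             (*-cong x+d≈y x+d≈y))
      (x≤x+d _ (+-nonneg (*-nonneg 0≤d (+-nonneg 0≤x 0≤x)) (*-nonneg 0≤d 0≤d)))

    square≈0 : ∀ {x} → x * x ≈ 0# → x ≈ 0#
    square≈0 {x} x²≈0 with x ≟ 0#
    ... | yes x≈0 = x≈0
    ... | no x≉0 with inverse x x≉0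
    ...   | y , xy≈1 = trans (sym (*-identityʳ x)) (trans (*-congˡ (sym xy≈1))
      (trans (sym (*-assoc x x y)) (trans (*-congʳ x²≈0) (zeroˡ y))))

    inverse-nonneg : ∀ {x y} → 0# ≤ x → x * y ≈ 1# → 0# ≤ y
    inverse-nonneg {x} {y} 0≤x xy≈1 = ≤-respʳ-≈
      (trans (sym (*-assoc x y y)) (trans (*-congʳ xy≈1) (*-identityˡ y)))
      (*-nonneg 0≤x (square-nonneg y))

  sqrt : ∀ a → 0# ≤ a → ∃ (IsSqrt a)
  sqrt a 0≤a = s , 0≤s , s²≈a
    where
    S : Carrier → Set ℓ
    S x = x * x ≤ a

    0∈S : S 0#
    0∈S = ≤-respˡ-≈ (sym (zeroˡ 0#)) 0≤a

    bound : IsUpperBound S (1# + a)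
    bound x x²≤a with total x (1# + a)
    ... | inj₁ x≤1+a = x≤1+a
    ... | inj₂ 1+a≤x = ⊥-elim (0≉1 (antisym 0≤1 (≤-trans
            (x≤x+d 1# (+-nonneg 0≤a (*-nonneg 0≤a 0≤a)))
            (x+d≤x⇒d≤0 a (≤-respˡ-≈
              (solve 1 (λ a → (con 1 :+ a) :* (con 1 :+ a) := a :+ (con 1 :+ (a :+ a :* a))) refl a)
              (≤-trans (square-mono (+-nonneg 0≤1 0≤a) 1+a≤x) x²≤a))))))

    supremum : ∃ (IsSupremum S)
    supremum = completeness S (0# , 0∈S) (1# + a , bound)

    s : Carrier
    s = proj₁ supremum

    s-upper : IsUpperBound S s
    s-upper = proj₁ (proj₂ supremum)

    0≤s : 0# ≤ s
    0≤s = s-upper 0# 0∈S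

    -- If s² + d = a with d > 0, then (s + η)² ≤ a for some η > 0.
    not-below : ∀ {d} → 0# ≤ d → s * s + d ≈ a → ¬ (d ≈ 0#) → ⊥
    not-below {d} 0≤d s²+d≈a d≉0 = d≉0 (trans (sym ηe≈d) (trans (*-congʳ η≈0) (zeroˡ e)))
      where
      c e : Carrier
      c = 1# + (s + s)
      e = c + d

      0≤2s : 0# ≤ s + s
      0≤2s = +-nonneg 0≤s 0≤s

      0≤c : 0# ≤ c
      0≤c = +-nonneg 0≤1 0≤2s

      e≉0 : ¬ (e ≈ 0#)
      e≉0 e≈0 = 0≉1 (antisym 0≤1
        (≤-trans (x≤x+d 1# 0≤2s) (≤-trans (x≤x+d c 0≤d) (≤-reflexive e≈0))))

      i : Carrier
      i = proj₁ (inverse e e≉0)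

      ei≈1 : e * i ≈ 1#
      ei≈1 = proj₂ (inverse e e≉0)

      0≤i : 0# ≤ i
      0≤i = inverse-nonneg (+-nonneg 0≤c 0≤d) ei≈1

      η : Carrier
      η = d * i

      0≤η : 0# ≤ η
      0≤η = *-nonneg 0≤d 0≤i

      ηe≈d : η * e ≈ d
      ηe≈d = trans (*-assoc d i e) (trans (*-congˡ (trans (*-comm i e) ei≈1)) (*-identityʳ d))

      expand : (s + η) * (s + η) + (η * (c * i) + η * d) ≈ a
      expand = begin
        (s + η) * (s + η) + (η * (c * i) + η * d)
          ≈⟨ solve 4 (λ s d c i → let η = d :* i in
               (s :+ η) :* (s :+ η) :+ (η :* (c :* i) :+ η :* d)
               := s :* s :+ (η :* ((c :+ d) :* i) :+ η :* ((s :+ s) :+ d)))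
               refl s d c i ⟩
        s * s + (η * (e * i) + η * ((s + s) + d))
          ≈⟨ +-congˡ (+-congʳ (*-congˡ ei≈1)) ⟩
        s * s + (η * 1# + η * ((s + s) + d))
          ≈⟨ solve 3 (λ s η d → s :* s :+ (η :* con 1 :+ η :* ((s :+ s) :+ d))
               := s :* s :+ η :* ((con 1 :+ (s :+ s)) :+ d)) refl s η d ⟩
        s * s + η * e
          ≈⟨ +-congˡ ηe≈d ⟩
        s * s + d
          ≈⟨ s²+d≈a ⟩
        a ∎
        where open import Relation.Binary.Reasoning.Setoid setoid

      s+η∈S : S (s + η)
      s+η∈S = ≤-respʳ-≈ expand
        (x≤x+d _ (+-nonneg (*-nonneg 0≤η (*-nonneg 0≤c 0≤i)) (*-nonneg 0≤η 0≤d)))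

      η≈0 : η ≈ 0#
      η≈0 = antisym (x+d≤x⇒d≤0 s (s-upper (s + η) s+η∈S)) 0≤η

    -- If a + d = s² with d > 0, then t = (s² + a) / 2s < s also bounds S.
    not-above : ∀ {d} → 0# ≤ d → a + d ≈ s * s → ¬ (d ≈ 0#) → ⊥
    not-above {d} 0≤d a+d≈s² d≉0 = δ≉0 δ≈0
      where
      w : Carrier
      w = s + s

      w≉0 : ¬ (w ≈ 0#)
      w≉0 w≈0 = d≉0 (antisym (≤-trans d≤s² (≤-reflexive s²≈0)) 0≤d)
        where
        s≈0 : s ≈ 0#
        s≈0 = antisym (≤-trans (x≤x+d s 0≤s) (≤-reflexive w≈0)) 0≤s
        s²≈0 : s * s ≈ 0#
        s²≈0 = trans (*-congʳ s≈0) (zeroˡ s)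
        d≤s² : d ≤ s * s
        d≤s² = ≤-trans (x≤x+d d 0≤a) (≤-reflexive (trans (+-comm d a) a+d≈s²))

      i : Carrier
      i = proj₁ (inverse w w≉0)

      wi≈1 : w * i ≈ 1#
      wi≈1 = proj₂ (inverse w w≉0)

      0≤i : 0# ≤ i
      0≤i = inverse-nonneg (+-nonneg 0≤s 0≤s) wi≈1

      δ t : Carrier
      δ = d * i
      t = (s * s + a) * i

      0≤δ : 0# ≤ δ
      0≤δ = *-nonneg 0≤d 0≤i

      0≤t : 0# ≤ t
      0≤t = *-nonneg (+-nonneg (*-nonneg 0≤s 0≤s) 0≤a) 0≤i

      δw≈d : δ * w ≈ d
      δw≈d = trans (*-assoc d i w) (trans (*-congˡ (trans (*-comm i w) wi≈1)) (*-identityʳ d))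

      δ≉0 : ¬ (δ ≈ 0#)
      δ≉0 δ≈0 = d≉0 (trans (sym δw≈d) (trans (*-congʳ δ≈0) (zeroˡ w)))

      open import Relation.Binary.Reasoning.Setoid setoid

      t+δ≈s : t + δ ≈ s
      t+δ≈s = begin
        (s * s + a) * i + d * i
          ≈⟨ solve 4 (λ s a d i → (s :* s :+ a) :* i :+ d :* i
               := (s :* s :+ (a :+ d)) :* i) refl s a d i ⟩
        (s * s + (a + d)) * i
          ≈⟨ *-congʳ (+-congˡ a+d≈s²) ⟩
        (s * s + s * s) * i
          ≈⟨ solve 2 (λ s i → (s :* s :+ s :* s) :* i := s :* ((s :+ s) :* i)) refl s i ⟩
        s * (w * i)
          ≈⟨ *-congˡ wi≈1 ⟩
        s * 1#
          ≈⟨ *-identityʳ s ⟩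
        s ∎

      t²≈a+δ² : t * t ≈ a + δ * δ
      t²≈a+δ² = sym (+-cancelˡ (δ * (t + t) + δ * δ) _ _ (begin
        (δ * (t + t) + δ * δ) + (a + δ * δ)
          ≈⟨ solve 3 (λ δ t a → (δ :* (t :+ t) :+ δ :* δ) :+ (a :+ δ :* δ)
               := a :+ δ :* ((t :+ δ) :+ (t :+ δ))) refl δ t a ⟩
        a + δ * ((t + δ) + (t + δ))
          ≈⟨ +-congˡ (*-congˡ (+-cong t+δ≈s t+δ≈s)) ⟩
        a + δ * w
          ≈⟨ +-congˡ δw≈d ⟩
        a + d
          ≈⟨ a+d≈s² ⟩
        s * s
          ≈⟨ *-cong t+δ≈s t+δ≈s ⟨
        (t + δ) * (t + δ)
          ≈⟨ solve 2 (λ δ t → (t :+ δ) :* (t :+ δ)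
               := (δ :* (t :+ t) :+ δ :* δ) :+ t :* t) refl δ t ⟩
        (δ * (t + t) + δ * δ) + t * t ∎))

      t-upper : IsUpperBound S t
      t-upper x x²≤a with total x t
      ... | inj₁ x≤t = x≤t
      ... | inj₂ t≤x = ⊥-elim (δ≉0 (square≈0 (antisym
              (x+d≤x⇒d≤0 a (≤-respˡ-≈ t²≈a+δ² (≤-trans (square-mono 0≤t t≤x) x²≤a)))
              (square-nonneg δ))))

      δ≈0 : δ ≈ 0#
      δ≈0 = antisym (x+d≤x⇒d≤0 t (≤-respˡ-≈ (sym t+δ≈s) (proj₂ (proj₂ supremum) t t-upper))) 0≤δ

    s²≈a : s * s ≈ a
    s²≈a with (s * s) ≟ a | total (s * s) a
    ... | yes s²≈a | _ = s²≈a
    ... | no  s²≉a | inj₁ s²≤a with difference s²≤a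
    ...   | d , 0≤d , eq = ⊥-elim (not-below 0≤d eq λ d≈0 →
              s²≉a (trans (sym (trans (+-congˡ d≈0) (+-identityʳ _))) eq))
    s²≈a | no  s²≉a | inj₂ a≤s² with difference a≤s²
    ...   | d , 0≤d , eq = ⊥-elim (not-above 0≤d eq λ d≈0 →
              s²≉a (sym (trans (sym (trans (+-congˡ d≈0) (+-identityʳ _))) eq)))

  fromℕ-nonneg : ∀ n → 0# ≤ fromℕ n
  fromℕ-nonneg zero    = ≤-reflexive refl
  fromℕ-nonneg (suc n) = +-nonneg 0≤1 (fromℕ-nonneg n)

  √_ : ℕ → Carrier
  √ n = proj₁ (sqrt (fromℕ n) (fromℕ-nonneg n))

count : ∀ {n} {P : U.Pred (Fin n) 0ℓ} → U.Decidable P → ℕ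
count {n} P? = length (filter P? (allFin n))

record SimpleGraph (n : ℕ) : Set₁ where
  infix 4 _~_ _~?_
  field
    _~_     : Rel (Fin n) 0ℓ
    _~?_    : B.Decidable _~_
    ~-sym   : ∀ {u v} → u ~ v → v ~ u
    ~-irrefl : ∀ {v} → ¬ (v ~ v)

  degree : Fin n → ℕ
  degree v = count (v ~?_)

  Walk : Rel (Fin n) 0ℓ
  Walk = Star _~_

  walkLength : ∀ {u v} → Walk u v → ℕ
  walkLength ε       = 0
  walkLength (_ ◅ w) = suc (walkLength w)

  vertices : ∀ {u v} → Walk u v → List (Fin n)
  vertices {u} ε       = u ∷ []
  vertices {u} (_ ◅ w) = u ∷ vertices w

  IsPath : ∀ {u v} → Walk u v → Set
  IsPath w = Unique (vertices w)

  IsDistance : Fin n → Fin n → ℕ → Set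
  IsDistance u v l = (∃ λ (w : Walk u v) → walkLength w ≡ l)
                   × (∀ (w : Walk u v) → l ℕ.≤ walkLength w)

  -- Any two vertices are joined by exactly one path.
  IsTree : Set
  IsTree = ∀ u v → (∃ λ (p : Walk u v) → IsPath p)
                 × (∀ (p q : Walk u v) → IsPath p → IsPath q → vertices p ≡ vertices q)

record GeneralizedBetheTree (k : ℕ) : Set₁ where
  field
    order  : ℕ
    graph  : SimpleGraph order
  open SimpleGraph graph public
  field
    isTree     : IsTree
    root       : Fin order
    dist       : Fin order → ℕ
    isDistance : ∀ v → IsDistance root v (dist v)

  level : Fin order → ℕ
  level v = suc (dist v)

  -- Level j corresponds to index k - j + 1.
  index : Fin order → ℕ
  index v = suc k ∸ level v

  field
    level≤k  : ∀ v → level v ℕ.≤ k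
    deepest  : ∃ λ v → level v ≡ k
    d        : ℕ → ℕ    -- only d 1, …, d k matter
    degree≡d : ∀ v → degree v ≡ d (index v)

  -- n (suc i) ≤ n i for 1 ≤ i < k, so n i ∸ n (suc i) is exact there.
  n : ℕ → ℕ
  n i = count (λ v → index v ℕ.≟ i)

module Spectral {ℓ} (R : Reals ℓ) where
  open Reals R
  open SquareRoot R using (√_)
  open Sum semiring using (sum)

  Matrix : ℕ → ℕ → Set ℓ
  Matrix m n = Vector (Vector Carrier n) m

  infixr 7 _*ᵥ_
  _*ᵥ_ : ∀ {m n} → Matrix m n → Vector Carrier n → Vector Carrier m
  (M *ᵥ v) i = sum (λ j → M i j * v j)

  linearCombination : ∀ {m n} → Vector Carrier m → Vector (Vector Carrier n) m → Vector Carrier n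
  linearCombination c b i = sum (λ j → c j * b j i)

  Eigenspace : ∀ {n} → Matrix n n → Carrier → Vector Carrier n → Set ℓ
  Eigenspace M x v = ∀ i → (M *ᵥ v) i ≈ x * v i

  IsEigenvalue : ∀ {n} → Matrix n n → Carrier → Set ℓ
  IsEigenvalue M x = ∃ λ v → Eigenspace M x v × ¬ (∀ i → v i ≈ 0#)

  IsLargestEigenvalue : ∀ {n} → Matrix n n → Carrier → Set ℓ
  IsLargestEigenvalue M x = IsEigenvalue M x × (∀ y → IsEigenvalue M y → y ≤ x)

  record IsBasis {m n} (V : Vector Carrier n → Set ℓ) (b : Vector (Vector Carrier n) m) : Set ℓ where
    field
      member      : ∀ j → V (b j)
      independent : ∀ c → (∀ i → linearCombination c b i ≈ 0#) → ∀ j → c j ≈ 0#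
      spanning    : ∀ v → V v → ∃ λ c → ∀ i → v i ≈ linearCombination c b i

  -- Dimension of the eigenspace; this is the multiplicity of x because all
  -- matrices considered below are real symmetric.  It is 0 exactly when x is
  -- not an eigenvalue.
  HasMultiplicity : ∀ {n} → Matrix n n → Carrier → ℕ → Set ℓ
  HasMultiplicity {n} M x m =
    ∃ λ (b : Vector (Vector Carrier n) m) → IsBasis (Eigenspace M x) b

  -- Multisets of real numbers, given by their multiplicity functions.
  Multiset : Set ℓ
  Multiset = Carrier → ℕ

  infixl 6 _⊎_
  _⊎_ : Multiset → Multiset → Multiset
  (σ ⊎ τ) x = σ x ℕ.+ τ x

  infixl 7 _⊗_
  _⊗_ : ℕ → Multiset → Multiset
  (m ⊗ σ) x = m ℕ.* σ x

  -- ⨄ m σ = σ 1 ⊎ … ⊎ σ m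
  ⨄ : ℕ → (ℕ → Multiset) → Multiset
  ⨄ zero    σ = λ _ → 0
  ⨄ (suc m) σ = ⨄ m σ ⊎ σ (suc m)

  IsSpectrum : ∀ {n} → Matrix n n → Multiset → Set ℓ
  IsSpectrum M σ = ∀ x → HasMultiplicity M x (σ x)

  module _ {n} (G : SimpleGraph n) where
    open SimpleGraph G

    adjacencyMatrix : Matrix n n
    adjacencyMatrix u v = if does (u ~? v) then 1# else 0#

    degreeMatrix : Matrix n n
    degreeMatrix u v = if does (u Fin.≟ v) then fromℕ (degree u) else 0#

    A[_] : Carrier → Matrix n n
    A[ α ] u v = α * degreeMatrix u v + (1# - α) * adjacencyMatrix u v

  leading : ∀ {j k} → j ℕ.≤ k → Matrix k k → Matrix j j
  leading j≤k M p q = M (inject≤ p j≤k) (inject≤ q j≤k)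

  module _ {k} (B : GeneralizedBetheTree k) (α : Carrier) where
    open GeneralizedBetheTree B using (d)

    β : Carrier
    β = 1# - α

    -- Rows and columns are numbered from 1 here, as are d 1, …, d k.
    diagonal : ℕ → Carrier
    diagonal s = if does (s ℕ.≟ 1) then α else α * fromℕ (d s)

    -- The entries (s - 1, s) and (s, s - 1).  Here d s ≥ 1, so that the
    -- truncated subtraction is exact.
    offDiagonal : ℕ → Carrier
    offDiagonal s = if does (s ℕ.≟ k) then β * √ (d s) else β * √ (d s ∸ 1)

    entry : ℕ → ℕ → Carrier
    entry s t =
      if      does (s ℕ.≟ t)     then diagonal s
      else if does (suc s ℕ.≟ t) then offDiagonal t
      else if does (s ℕ.≟ suc t) then offDiagonal s
      else 0#

    T : Matrix k k
    T p q = entry (suc (toℕ p)) (suc (toℕ q))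

{-# OPTIONS --safe #-}
module Submission where

open import Defs
open import Algebra.Bundles using (CommutativeSemiring)
import Algebra.Properties.Ring as RingProperties
import Algebra.Properties.Semiring.Mult as Mult
import Algebra.Properties.Semiring.Sum as Sum
import Algebra.Solver.Ring.NaturalCoefficients.Default as Solver
open import Data.Bool.Base using (if_then_else_; true; false)
open import Data.Empty using (⊥-elim)
open import Data.Fin.Base using (Fin; zero; suc; toℕ; fromℕ<)
import Data.Fin.Properties as Fin
open import Data.List.Base using (List; []; _∷_; length; filter; tabulate)
import Data.List.Properties as List
open import Data.List.Relation.Unary.All as All using (All; []; _∷_)
open import Data.List.Relation.Unary.AllPairs using ([]; _∷_)
open import Data.Nat.Base as ℕ using (ℕ; zero; suc; z≤n; s≤s; _∸_)
import Data.Nat.Properties as ℕ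
open import Data.Product.Base using (∃; _×_; _,_; proj₁; proj₂)
open import Data.Sum.Base using (inj₁; inj₂) renaming (_⊎_ to _∨_)
open import Function.Base using (_∘_; id)
import Level
open import Relation.Binary.Construct.Closure.ReflexiveTransitive using (ε; _◅_; _◅◅_)
open import Relation.Binary.Definitions using (tri<; tri≈; tri>)
open import Relation.Binary.PropositionalEquality.Core as ≡ using (_≡_; _≢_)
open import Relation.Binary.PropositionalEquality.Properties using (module ≡-Reasoning)
open import Relation.Binary.Structures using (IsDecTotalOrder)
open import Relation.Nullary.Decidable using (Dec; yes; no; does; ¬?; _×-dec_; dec-true; dec-false)
open import Relation.Nullary.Negation using (¬_)
open import Relation.Unary using (Decidable; Pred)

-- For fixed x let f 0 = 0, f 1 = 1 and β f (s+1) = (x − D s) f s − β μ s f (s−1), where D s is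
-- the diagonal entry of T and μ s the number of children of a vertex of index s.  As the
-- off-diagonal entries of T are β √ (μ s), a diagonal similarity shows that the eigenspace of T_j
-- at x is a line if f (j+1) = 0 and trivial otherwise.  On the tree, working up from the leaves
-- and averaging over children, an eigenvector v of A_α at x has the form v u = t u · f (index u),
-- where t u is the average of t over the children of u and t does not change from the parent of u
-- to u unless f (index u + 1) = 0 (with t = 0 above the root).  So v amounts to increments of t
-- at the vertices u with f (index u + 1) = 0, subject to one linear relation per set of siblings;
-- leaving out one child ("heir") of every vertex gives a basis, and n_j − n_{j+1} vertices of
-- index j < k are not heirs.  Finally, f is positive on 1, …, k at the largest x with
-- f (k+1) = 0, which gives positive eigenvectors of both nonnegative matrices, whence this x is
-- the largest eigenvalue of each of them.


-- Dividing `v u` by `f (index u)` cannot define `t`, because `f` may vanish. As `f 1 = 1`, `t` can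
-- instead start as `v` on the deepest level and be averaged upwards, which divides only by numbers
-- of children. At the root the parent's term is missing, and the eigenvalue equation there becomes
-- `t root * f (k + 1) = 0`. The root thus obeys the same rule as every other vertex; being the only
-- vertex of index `k` and never an heir, it accounts for the multiplicity 1 of T_k. A multiplicity
-- is the size of some basis, so the sizes assumed for the T_j must be shown to be the expected
-- ones. Eigenspaces there are at most lines, hence uniqueness of dimension is needed only in
-- dimensions 0 and 1; for A_α one explicit basis suffices. Square roots enter through the diagonal
-- similarity alone: `f` contains only their squares `μ`, so the tree side never meets them.

-- Finite sums and indicators.

module FiniteSum {c ℓ} (S : CommutativeSemiring c ℓ) where
  open CommutativeSemiring S hiding (zero)
  open Sum semiring using (*-distribˡ-sum)
  open Sum semiring public using (sum; sum-cong-≋; ∑-distrib-+; ∑-comm; sum-replicate-zero)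
  open import Relation.Binary.Reasoning.Setoid setoid

  ind : ∀ {p} {P : Set p} → Dec P → Carrier
  ind P? = if does P? then 1# else 0#

  ind-true : ∀ {p} {P : Set p} (P? : Dec P) → P → ind P? ≈ 1#
  ind-true (yes _) _ = refl
  ind-true (no ¬p) p = ⊥-elim (¬p p)

  ind-false : ∀ {p} {P : Set p} (P? : Dec P) → ¬ P → ind P? ≈ 0#
  ind-false (yes p) ¬p = ⊥-elim (¬p p)
  ind-false (no _)  _  = refl

  ind-⇔ : ∀ {p q} {P : Set p} {Q : Set q} (P? : Dec P) (Q? : Dec Q) →
          (P → Q) → (Q → P) → ind P? ≈ ind Q?
  ind-⇔ (yes p) Q? f g = sym (ind-true Q? (f p))
  ind-⇔ (no ¬p) Q? f g = sym (ind-false Q? (¬p ∘ g))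

  ind-* : ∀ {p q} {P : Set p} {Q : Set q} (P? : Dec P) (Q? : Dec Q) →
          ind (P? ×-dec Q?) ≈ ind P? * ind Q?
  ind-* (yes _) (yes _) = sym (*-identityˡ 1#)
  ind-* (yes _) (no _)  = sym (zeroʳ 1#)
  ind-* (no _)  Q?      = sym (zeroˡ _)

  ind-split : ∀ {p q} {P : Set p} {Q : Set q} (P? : Dec P) (Q? : Dec Q) →
              ind P? ≈ ind (P? ×-dec Q?) + ind (P? ×-dec ¬? Q?)
  ind-split (yes _) (yes _) = sym (+-identityʳ 1#)
  ind-split (yes _) (no _)  = sym (+-identityˡ 1#)
  ind-split (no _)  _       = sym (+-identityʳ 0#)

  ind-cong : ∀ {p} {P : Set p} (P? : Dec P) {x y} → (P → x ≈ y) → ind P? * x ≈ ind P? * y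
  ind-cong (yes p) x≈y = *-congˡ (x≈y p)
  ind-cong (no _)  _   = trans (zeroˡ _) (sym (zeroˡ _))

  sum-*ˡ : ∀ {n} x (g : Fin n → Carrier) → sum (λ i → x * g i) ≈ x * sum g
  sum-*ˡ x g = sym (*-distribˡ-sum x g)

  sum-*ʳ : ∀ {n} (g : Fin n → Carrier) x → sum (λ i → g i * x) ≈ sum g * x
  sum-*ʳ g x = trans (sum-cong-≋ λ i → *-comm (g i) x) (trans (sum-*ˡ x g) (*-comm x _))

  sum-zero : ∀ {n} (g : Fin n → Carrier) → (∀ i → g i ≈ 0#) → sum g ≈ 0#
  sum-zero {n} g g≈0 = trans (sum-cong-≋ g≈0) (sum-replicate-zero n)

  sum-none : ∀ {n p} {P : Pred (Fin n) p} (P? : Decidable P) (g : Fin n → Carrier) →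
             (∀ i → ¬ P i) → sum (λ i → ind (P? i) * g i) ≈ 0#
  sum-none P? g none = sum-zero _ λ i → trans (*-congʳ (ind-false (P? i) (none i))) (zeroˡ _)

  sum-only : ∀ {n p} {P : Pred (Fin n) p} (P? : Decidable P) (g : Fin n → Carrier) {i} →
             P i → (∀ j → P j → j ≡ i) → sum (λ j → ind (P? j) * g j) ≈ g i
  sum-only P? g {zero} p₀ unique = begin
    ind (P? zero) * g zero + sum (λ j → ind (P? (suc j)) * g (suc j))
      ≈⟨ +-cong (*-congʳ (ind-true (P? zero) p₀))
                (sum-none (P? ∘ suc) (g ∘ suc) λ j pj → Fin.0≢1+n (≡.sym (unique (suc j) pj))) ⟩
    1# * g zero + 0#  ≈⟨ +-identityʳ _ ⟩
    1# * g zero       ≈⟨ *-identityˡ _ ⟩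
    g zero            ∎
  sum-only P? g {suc i} pᵢ unique = begin
    ind (P? zero) * g zero + sum (λ j → ind (P? (suc j)) * g (suc j))
      ≈⟨ +-cong (trans (*-congʳ (ind-false (P? zero) λ p₀ → Fin.0≢1+n (unique zero p₀))) (zeroˡ _))
                (sum-only (P? ∘ suc) (g ∘ suc) pᵢ λ j pj → Fin.suc-injective (unique (suc j) pj)) ⟩
    0# + g (suc i)    ≈⟨ +-identityˡ _ ⟩
    g (suc i)         ∎

  -- Double counting of the pairs (i , f i) with P i.
  sum-bijection : ∀ {m n p q} {P : Pred (Fin m) p} {Q : Pred (Fin n) q}
    (P? : Decidable P) (Q? : Decidable Q) (f : Fin m → Fin n) (g : Fin n → Fin m) →
    (∀ {i} → P i → Q (f i) × g (f i) ≡ i) → (∀ {j} → Q j → P (g j) × f (g j) ≡ j) →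
    sum (ind ∘ P?) ≈ sum (ind ∘ Q?)
  sum-bijection {P = P} {Q} P? Q? f g P⇒Q Q⇒P = begin
    sum (ind ∘ P?)
      ≈⟨ sum-cong-≋ (λ i → sym (expand (ind (P? i)) (f i))) ⟩
    sum (λ i → sum λ j → ind (j Fin.≟ f i) * ind (P? i))
      ≈⟨ ∑-comm (λ i j → ind (j Fin.≟ f i) * ind (P? i)) ⟩
    sum (λ j → sum λ i → ind (j Fin.≟ f i) * ind (P? i))
      ≈⟨ sum-cong-≋ (λ j → sum-cong-≋ λ i → pairs i j) ⟩
    sum (λ j → sum λ i → ind (i Fin.≟ g j) * ind (Q? j))
      ≈⟨ sum-cong-≋ (λ j → expand (ind (Q? j)) (g j)) ⟩
    sum (ind ∘ Q?) ∎
    where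
    expand : ∀ {n} x (i : Fin n) → sum (λ j → ind (j Fin.≟ i) * x) ≈ x
    expand x i = sum-only (Fin._≟ i) (λ _ → x) ≡.refl λ _ eq → eq
    pairs : ∀ i j → ind (j Fin.≟ f i) * ind (P? i) ≈ ind (i Fin.≟ g j) * ind (Q? j)
    pairs i j = begin
      ind (j Fin.≟ f i) * ind (P? i)    ≈⟨ ind-* (j Fin.≟ f i) (P? i) ⟨
      ind ((j Fin.≟ f i) ×-dec P? i)
        ≈⟨ ind-⇔ ((j Fin.≟ f i) ×-dec P? i) ((i Fin.≟ g j) ×-dec Q? j)
             (λ { (≡.refl , pi) → ≡.sym (proj₂ (P⇒Q pi)) , proj₁ (P⇒Q pi) })
             (λ { (≡.refl , qj) → ≡.sym (proj₂ (Q⇒P qj)) , proj₁ (Q⇒P qj) }) ⟩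
      ind ((i Fin.≟ g j) ×-dec Q? j)    ≈⟨ ind-* (i Fin.≟ g j) (Q? j) ⟩
      ind (i Fin.≟ g j) * ind (Q? j)    ∎

-- Arithmetic and order in the real field.

module OrderedField {ℓ} (R : Reals ℓ) where
  open Reals R hiding (zero)
  open IsDecTotalOrder isDecTotalOrder public
    using (_≟_; total; antisym; ≤-respʳ-≈; ≤-respˡ-≈)
    renaming (refl to ≤-refl; trans to ≤-trans; reflexive to ≤-reflexive)
  open RingProperties ring public
    using (-‿distribˡ-*; -‿distribʳ-*; -‿involutive; -0#≈0#; -‿+-comm; +-cancelˡ; +-cancelʳ)
  open Solver commutativeSemiring public using (solve; _:+_; _:*_; _:=_; con)
  open FiniteSum commutativeSemiring
  open import Relation.Binary.Reasoning.Setoid setoid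

  1≉0 : ¬ (1# ≈ 0#)
  1≉0 = 0≉1 ∘ sym

  ≤-resp : ∀ {x x′ y y′} → x ≈ x′ → y ≈ y′ → x ≤ y → x′ ≤ y′
  ≤-resp x≈x′ y≈y′ = ≤-respˡ-≈ x≈x′ ∘ ≤-respʳ-≈ y≈y′

  <-resp : ∀ {x x′ y y′} → x ≈ x′ → y ≈ y′ → x < y → x′ < y′
  <-resp x≈x′ y≈y′ (x≤y , x≉y) = ≤-resp x≈x′ y≈y′ x≤y , λ x′≈y′ → x≉y (trans x≈x′ (trans x′≈y′ (sym y≈y′)))

  +-mono-≤ : ∀ {w x y z} → w ≤ x → y ≤ z → w + y ≤ x + z
  +-mono-≤ {w} {x} {y} {z} w≤x y≤z = ≤-trans (+-monoʳ-≤ w y≤z)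
    (≤-resp (+-comm z w) (+-comm z x) (+-monoʳ-≤ z w≤x))

  +-nonneg : ∀ {x y} → 0# ≤ x → 0# ≤ y → 0# ≤ x + y
  +-nonneg 0≤x 0≤y = ≤-respˡ-≈ (+-identityʳ 0#) (+-mono-≤ 0≤x 0≤y)

  x≤x+d : ∀ x {d} → 0# ≤ d → x ≤ x + d
  x≤x+d x 0≤d = ≤-respˡ-≈ (+-identityʳ x) (+-monoʳ-≤ x 0≤d)

  +-cancelˡ-≤ : ∀ z {x y} → z + x ≤ z + y → x ≤ y
  +-cancelˡ-≤ z z+x≤z+y = ≤-resp (cancel _) (cancel _) (+-monoʳ-≤ (- z) z+x≤z+y)
    where
    cancel : ∀ x → - z + (z + x) ≈ x
    cancel x = trans (sym (+-assoc _ _ _)) (trans (+-congʳ (-‿inverseˡ z)) (+-identityˡ x))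

  ≤⇒0≤- : ∀ {x y} → x ≤ y → 0# ≤ y + - x
  ≤⇒0≤- {x} {y} x≤y = ≤-resp (-‿inverseˡ x) (+-comm _ _) (+-monoʳ-≤ (- x) x≤y)

  y-x+x≈y : ∀ x y → (y + - x) + x ≈ y
  y-x+x≈y x y = trans (+-assoc _ _ _) (trans (+-congˡ (-‿inverseˡ x)) (+-identityʳ y))

  x+[y-x]≈y : ∀ x y → x + (y + - x) ≈ y
  x+[y-x]≈y x y = trans (+-comm _ _) (y-x+x≈y x y)

  0≤-⇒≤ : ∀ {x y} → 0# ≤ y + - x → x ≤ y
  0≤-⇒≤ {x} {y} 0≤d = ≤-respʳ-≈ (x+[y-x]≈y x y) (x≤x+d x 0≤d)

  neg-anti : ∀ {x y} → x ≤ y → - y ≤ - x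
  neg-anti {x} {y} x≤y = 0≤-⇒≤ (≤-respʳ-≈
    (trans (+-comm _ _) (+-congˡ (sym (-‿involutive y)))) (≤⇒0≤- x≤y))

  ≤0⇒0≤- : ∀ {x} → x ≤ 0# → 0# ≤ - x
  ≤0⇒0≤- x≤0 = ≤-respˡ-≈ -0#≈0# (neg-anti x≤0)

  *-monoˡ-≤ : ∀ {z x y} → 0# ≤ z → x ≤ y → z * x ≤ z * y
  *-monoˡ-≤ {z} {x} {y} 0≤z x≤y = ≤-respʳ-≈
    (trans (sym (distribˡ z x _)) (*-congˡ (x+[y-x]≈y x y)))
    (x≤x+d (z * x) (*-nonneg 0≤z (≤⇒0≤- x≤y)))

  *-monoʳ-≤ : ∀ {z x y} → 0# ≤ z → x ≤ y → x * z ≤ y * z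
  *-monoʳ-≤ 0≤z x≤y = ≤-resp (*-comm _ _) (*-comm _ _) (*-monoˡ-≤ 0≤z x≤y)

  0≤1 : 0# ≤ 1#
  0≤1 with total 0# 1#
  ... | inj₁ 0≤1 = 0≤1
  ... | inj₂ 1≤0 = ≤-respʳ-≈ -1*-1≈1 (*-nonneg (≤0⇒0≤- 1≤0) (≤0⇒0≤- 1≤0))
    where
    -1*-1≈1 : - 1# * - 1# ≈ 1#
    -1*-1≈1 = trans (sym (-‿distribˡ-* 1# (- 1#))) (trans (-‿cong (*-identityˡ _)) (-‿involutive 1#))

  0<1 : 0# < 1#
  0<1 = 0≤1 , 0≉1

  0<⇒≉0 : ∀ {x} → 0# < x → ¬ (x ≈ 0#)
  0<⇒≉0 (_ , 0≉x) = 0≉x ∘ sym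

  <⇒≱ : ∀ {x y} → x < y → ¬ (y ≤ x)
  <⇒≱ (x≤y , x≉y) y≤x = x≉y (antisym x≤y y≤x)

  ≤⊎> : ∀ x y → x ≤ y ∨ y < x
  ≤⊎> x y with total x y | x ≟ y
  ... | inj₁ x≤y | _      = inj₁ x≤y
  ... | inj₂ _   | yes x≈y = inj₁ (≤-reflexive x≈y)
  ... | inj₂ y≤x | no x≉y  = inj₂ (y≤x , x≉y ∘ sym)

  <⇒0<- : ∀ {x y} → x < y → 0# < y + - x
  <⇒0<- {x} {y} (x≤y , x≉y) = ≤⇒0≤- x≤y , λ 0≈d → x≉y
    (trans (sym (+-identityʳ x)) (trans (+-congˡ 0≈d) (x+[y-x]≈y x y)))

  <-≤-trans : ∀ {x y z} → x < y → y ≤ z → x < z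
  <-≤-trans (x≤y , x≉y) y≤z = ≤-trans x≤y y≤z , λ x≈z → x≉y (antisym x≤y (≤-respʳ-≈ (sym x≈z) y≤z))

  0<+ : ∀ {x y} → 0# < x → 0# ≤ y → 0# < x + y
  0<+ {x} 0<x 0≤y = <-≤-trans 0<x (x≤x+d x 0≤y)

  *-cancelˡ : ∀ {z x y} → ¬ (z ≈ 0#) → z * x ≈ z * y → x ≈ y
  *-cancelˡ {z} {x} {y} z≉0 zx≈zy with inverse z z≉0
  ... | z⁻¹ , zz⁻¹≈1 = trans (sym (undo x)) (trans (*-congˡ zx≈zy) (undo y))
    where
    undo : ∀ x → z⁻¹ * (z * x) ≈ x
    undo x = trans (sym (*-assoc _ _ _))
      (trans (*-congʳ (trans (*-comm _ _) zz⁻¹≈1)) (*-identityˡ x))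

  *≈0⇒≈0 : ∀ {x y} → ¬ (x ≈ 0#) → x * y ≈ 0# → y ≈ 0#
  *≈0⇒≈0 x≉0 xy≈0 = *-cancelˡ x≉0 (trans xy≈0 (sym (zeroʳ _)))

  *≈0ʳ : ∀ x {y} → y ≈ 0# → x * y ≈ 0#
  *≈0ʳ x y≈0 = trans (*-congˡ y≈0) (zeroʳ x)

  *≈0ˡ : ∀ {x} y → x ≈ 0# → x * y ≈ 0#
  *≈0ˡ y x≈0 = trans (*-congʳ x≈0) (zeroˡ y)

  +≈0 : ∀ {x y} → x ≈ 0# → y ≈ 0# → x + y ≈ 0#
  +≈0 x≈0 y≈0 = trans (+-cong x≈0 y≈0) (+-identityʳ 0#)

  0<* : ∀ {x y} → 0# < x → 0# < y → 0# < x * y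
  0<* {x} {y} 0<x@(0≤x , _) 0<y@(0≤y , _) = *-nonneg 0≤x 0≤y ,
    λ 0≈xy → 0<⇒≉0 0<y (*≈0⇒≈0 (0<⇒≉0 0<x) (sym 0≈xy))

  *-cancelˡ-≤ : ∀ {z x y} → 0# < z → z * x ≤ z * y → x ≤ y
  *-cancelˡ-≤ {z} {x} {y} 0<z zx≤zy with ≤⊎> x y
  ... | inj₁ x≤y = x≤y
  ... | inj₂ y<x@(y≤x , y≉x) = ⊥-elim (y≉x (*-cancelˡ (0<⇒≉0 0<z)
          (antisym (*-monoˡ-≤ (proj₁ 0<z) y≤x) zx≤zy)))

  -- Junk value: inv x = 0 for x ≈ 0.
  inv : Carrier → Carrier
  inv x with x ≟ 0#
  ... | yes _  = 0#
  ... | no x≉0 = proj₁ (inverse x x≉0)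

  *-inverseʳ : ∀ {x} → ¬ (x ≈ 0#) → x * inv x ≈ 1#
  *-inverseʳ {x} x≉0 with x ≟ 0#
  ... | yes x≈0 = ⊥-elim (x≉0 x≈0)
  ... | no x≉0′ = proj₂ (inverse x x≉0′)

  x*[inv-x*y]≈y : ∀ {x} y → ¬ (x ≈ 0#) → x * (inv x * y) ≈ y
  x*[inv-x*y]≈y y x≉0 = trans (sym (*-assoc _ _ _)) (trans (*-congʳ (*-inverseʳ x≉0)) (*-identityˡ y))

  0<inv : ∀ {x} → 0# < x → 0# < inv x
  0<inv {x} 0<x with ≤⊎> (inv x) 0#
  ... | inj₂ 0<x⁻¹ = 0<x⁻¹
  ... | inj₁ x⁻¹≤0 = ⊥-elim (<⇒≱ 0<1
          (≤-resp (*-inverseʳ (0<⇒≉0 0<x)) (zeroʳ x) (*-monoˡ-≤ (proj₁ 0<x) x⁻¹≤0)))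

  0<fromℕ : ∀ {n} → 1 ℕ.≤ n → 0# < fromℕ n
  0<fromℕ {suc n} _ = 0<+ 0<1 (SquareRoot.fromℕ-nonneg R n)

  sum-mono-≤ : ∀ {n} {g h : Fin n → Carrier} → (∀ i → g i ≤ h i) → sum g ≤ sum h
  sum-mono-≤ {zero}  g≤h = ≤-refl
  sum-mono-≤ {suc n} g≤h = +-mono-≤ (g≤h zero) (sum-mono-≤ (g≤h ∘ suc))

  argmax : ∀ {n} (g : Fin (suc n) → Carrier) → ∃ λ i → ∀ j → g j ≤ g i
  argmax {zero}  g = zero , λ { zero → ≤-refl }
  argmax {suc n} g with argmax (g ∘ suc)
  ... | i , max with total (g zero) (g (suc i))
  ...   | inj₁ g0≤gi = suc i , λ { zero → g0≤gi ; (suc j) → max j }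
  ...   | inj₂ gi≤g0 = zero , λ { zero → ≤-refl ; (suc j) → ≤-trans (max j) gi≤g0 }

-- Largest eigenvalues from positive eigenvectors.

-- Comparing an eigenvector v of a nonnegative matrix with a positive one w at a
-- vertex where v / w is maximal.
module PositiveEigenvector {ℓ} (R : Reals ℓ) where
  open Reals R hiding (zero)
  open Spectral R
  open OrderedField R
  open FiniteSum commutativeSemiring
  open import Relation.Binary.Reasoning.Setoid setoid

  *ᵥ-scale : ∀ {m n} (M : Matrix m n) c v i → (M *ᵥ (λ j → c * v j)) i ≈ c * (M *ᵥ v) i
  *ᵥ-scale M c v i = trans
    (sum-cong-≋ λ j → solve 3 (λ a c v → a :* (c :* v) := c :* (a :* v)) refl (M i j) c (v j))
    (sum-*ˡ c (λ j → M i j * v j))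

  compare-eigenvalues : ∀ {n} (M : Matrix n n) → (∀ i j → 0# ≤ M i j) →
    ∀ {w v ρ y} → (∀ i → 0# < w i) → Eigenspace M ρ w → Eigenspace M y v → ∀ i → 0# < v i → y ≤ ρ
  compare-eigenvalues {suc n} M M≥0 {w} {v} {ρ} {y} w>0 w-eigen v-eigen i₀ 0<v₀ =
    *-cancelˡ-≤ (0<* 0<t (w>0 i)) (≤-resp lhs rhs step)
    where
    r : Fin (suc n) → Carrier
    r j = inv (w j) * v j
    v≈wr : ∀ j → w j * r j ≈ v j
    v≈wr j = x*[inv-x*y]≈y (v j) (0<⇒≉0 (w>0 j))
    i : Fin (suc n)
    i = proj₁ (argmax r)
    t : Carrier
    t = r i
    -- The positive coordinate at `i₀` makes the maximal ratio positive, so that `t * w i` can be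
    -- cancelled at the end.
    0<t : 0# < t
    0<t = <-≤-trans (0<* (0<inv (w>0 i₀)) 0<v₀) (proj₂ (argmax r) i₀)
    v≤tw : ∀ j → v j ≤ t * w j
    v≤tw j = ≤-resp (v≈wr j) (*-comm _ _) (*-monoˡ-≤ (proj₁ (w>0 j)) (proj₂ (argmax r) j))
    step : (M *ᵥ v) i ≤ (M *ᵥ (λ j → t * w j)) i
    step = sum-mono-≤ λ j → *-monoˡ-≤ (M≥0 i j) (v≤tw j)
    lhs : (M *ᵥ v) i ≈ (t * w i) * y
    lhs = begin
      (M *ᵥ v) i     ≈⟨ v-eigen i ⟩
      y * v i        ≈⟨ *-congˡ (v≈wr i) ⟨
      y * (w i * t)  ≈⟨ solve 3 (λ y w t → y :* (w :* t) := t :* w :* y) refl y (w i) t ⟩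
      (t * w i) * y  ∎
    rhs : (M *ᵥ (λ j → t * w j)) i ≈ (t * w i) * ρ
    rhs = begin
      (M *ᵥ (λ j → t * w j)) i  ≈⟨ *ᵥ-scale M t w i ⟩
      t * (M *ᵥ w) i            ≈⟨ *-congˡ (w-eigen i) ⟩
      t * (ρ * w i)             ≈⟨ solve 3 (λ t ρ w → t :* (ρ :* w) := t :* w :* ρ) refl t ρ (w i) ⟩
      (t * w i) * ρ             ∎

  module _ {n} (M : Matrix n n) (M≥0 : ∀ i j → 0# ≤ M i j) {w ρ} (w>0 : ∀ i → 0# < w i)
           (w-eigen : Eigenspace M ρ w) where

    -- The comparison needs a positive coordinate. A nonzero eigenvector has a nonzero coordinate,
    -- and if that one is negative the eigenvector is replaced by its negative.
    eigenvalue≤ρ : ∀ y → IsEigenvalue M y → y ≤ ρ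
    eigenvalue≤ρ y (v , v-eigen , v≉0)
      with Fin.¬∀⟶∃¬ n (λ i → v i ≈ 0#) (λ i → v i ≟ 0#) v≉0
    ... | i , vi≉0 with ≤⊎> (v i) 0#
    ...   | inj₂ 0<vi = compare-eigenvalues M M≥0 w>0 w-eigen v-eigen i 0<vi
    ...   | inj₁ vi≤0 = compare-eigenvalues M M≥0 w>0 w-eigen -v-eigen i 0<-vi
      where
      neg : ∀ x → - 1# * x ≈ - x
      neg x = trans (sym (-‿distribˡ-* 1# x)) (-‿cong (*-identityˡ x))
      -v-eigen : Eigenspace M y (λ j → - 1# * v j)
      -v-eigen j = begin
        (M *ᵥ (λ j → - 1# * v j)) j  ≈⟨ *ᵥ-scale M (- 1#) v j ⟩
        - 1# * (M *ᵥ v) j            ≈⟨ *-congˡ (v-eigen j) ⟩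
        - 1# * (y * v j)             ≈⟨ solve 3 (λ a y v → a :* (y :* v) := y :* (a :* v)) 
                                         refl (- 1#) y (v j) ⟩
        y * (- 1# * v j)             ∎
      0<-vi : 0# < - 1# * v i
      0<-vi = <-resp refl (sym (neg (v i))) (≤0⇒0≤- vi≤0 , λ 0≈-v → vi≉0
        (trans (sym (-‿involutive (v i))) (trans (-‿cong (sym 0≈-v)) -0#≈0#)))

    largestEigenvalue : Fin n → IsLargestEigenvalue M ρ
    largestEigenvalue i = (w , w-eigen , λ w≈0 → 0<⇒≉0 (w>0 i) (w≈0 i)) , eigenvalue≤ρ

-- Functions bounded on [-1, 1], in place of continuity.

module BoundedFunctions {ℓ} (R : Reals ℓ) where
  open Reals R hiding (zero)
  open OrderedField R

  infix 4 ∣_∣≤_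
  ∣_∣≤_ : Carrier → Carrier → Set ℓ
  ∣ a ∣≤ M = a ≤ M × - a ≤ M

  ∣∣≤-nonneg : ∀ {a M} → ∣ a ∣≤ M → 0# ≤ M
  ∣∣≤-nonneg {a} (a≤M , -a≤M) with total 0# a
  ... | inj₁ 0≤a = ≤-trans 0≤a a≤M
  ... | inj₂ a≤0 = ≤-trans (≤0⇒0≤- a≤0) -a≤M

  ∣∣≤-trans : ∀ {a M N} → ∣ a ∣≤ M → M ≤ N → ∣ a ∣≤ N
  ∣∣≤-trans (a≤M , -a≤M) M≤N = ≤-trans a≤M M≤N , ≤-trans -a≤M M≤N

  ∣0∣≤ : ∀ {M} → 0# ≤ M → ∣ 0# ∣≤ M
  ∣0∣≤ 0≤M = 0≤M , ≤-respˡ-≈ (sym -0#≈0#) 0≤M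

  ∣∣≤-of-nonneg : ∀ {a} → 0# ≤ a → ∣ a ∣≤ a
  ∣∣≤-of-nonneg 0≤a = ≤-refl , ≤-trans (≤-respʳ-≈ -0#≈0# (neg-anti 0≤a)) 0≤a

  ∣∣≤-neg : ∀ {a M} → ∣ a ∣≤ M → ∣ - a ∣≤ M
  ∣∣≤-neg (a≤M , -a≤M) = -a≤M , ≤-respˡ-≈ (sym (-‿involutive _)) a≤M

  ∣∣≤-+ : ∀ {a b M N} → ∣ a ∣≤ M → ∣ b ∣≤ N → ∣ a + b ∣≤ M + N
  ∣∣≤-+ (a≤M , -a≤M) (b≤N , -b≤N) =
    +-mono-≤ a≤M b≤N , ≤-respˡ-≈ (-‿+-comm _ _) (+-mono-≤ -a≤M -b≤N)

  private
    *-mono-nonneg : ∀ {a b M N} → 0# ≤ a → 0# ≤ b → a ≤ M → b ≤ N → a * b ≤ M * N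
    *-mono-nonneg 0≤a 0≤b a≤M b≤N =
      ≤-trans (*-monoˡ-≤ 0≤a b≤N) (*-monoʳ-≤ (≤-trans 0≤b b≤N) a≤M)

    *-upper : ∀ {a b M N} → ∣ a ∣≤ M → ∣ b ∣≤ N → a * b ≤ M * N
    *-upper {a} {b} ∣a∣≤M ∣b∣≤N with total 0# a | total 0# b
    ... | inj₁ 0≤a | inj₁ 0≤b = *-mono-nonneg 0≤a 0≤b (proj₁ ∣a∣≤M) (proj₁ ∣b∣≤N)
    ... | inj₁ 0≤a | inj₂ b≤0 = ≤-trans (≤-respʳ-≈ (zeroʳ a) (*-monoˡ-≤ 0≤a b≤0))
                                        (*-nonneg (∣∣≤-nonneg ∣a∣≤M) (∣∣≤-nonneg ∣b∣≤N))
    ... | inj₂ a≤0 | inj₁ 0≤b = ≤-trans (≤-respʳ-≈ (zeroˡ b) (*-monoʳ-≤ 0≤b a≤0))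
                                        (*-nonneg (∣∣≤-nonneg ∣a∣≤M) (∣∣≤-nonneg ∣b∣≤N))
    ... | inj₂ a≤0 | inj₂ b≤0 = ≤-respˡ-≈ -a*-b≈ab
      (*-mono-nonneg (≤0⇒0≤- a≤0) (≤0⇒0≤- b≤0) (proj₂ ∣a∣≤M) (proj₂ ∣b∣≤N))
      where
      -a*-b≈ab : - a * - b ≈ a * b
      -a*-b≈ab = trans (sym (-‿distribˡ-* a (- b)))
        (trans (-‿cong (sym (-‿distribʳ-* a b))) (-‿involutive _))

  ∣∣≤-* : ∀ {a b M N} → ∣ a ∣≤ M → ∣ b ∣≤ N → ∣ a * b ∣≤ M * N
  ∣∣≤-* {a} {b} ∣a∣≤M ∣b∣≤N = *-upper ∣a∣≤M ∣b∣≤N ,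
    ≤-respˡ-≈ (sym (-‿distribˡ-* a b)) (*-upper (∣∣≤-neg ∣a∣≤M) ∣b∣≤N)

  Bounded : (Carrier → Carrier) → Set ℓ
  Bounded φ = ∃ λ M → ∀ h → ∣ h ∣≤ 1# → ∣ φ h ∣≤ M

  bounded-const : ∀ c → Bounded (λ _ → c)
  bounded-const c with total 0# c
  ... | inj₁ 0≤c = c , λ _ _ → ∣∣≤-of-nonneg 0≤c
  ... | inj₂ c≤0 = - c , λ _ _ → ≤-trans c≤0 (≤0⇒0≤- c≤0) , ≤-refl

  bounded-id : Bounded (λ h → h)
  bounded-id = 1# , λ _ ∣h∣≤1 → ∣h∣≤1

  bounded-neg : ∀ {φ} → Bounded φ → Bounded (λ h → - φ h)
  bounded-neg (M , φ≤M) = M , λ h ∣h∣≤1 → ∣∣≤-neg (φ≤M h ∣h∣≤1)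

  bounded-+ : ∀ {φ ψ} → Bounded φ → Bounded ψ → Bounded (λ h → φ h + ψ h)
  bounded-+ (M , φ≤M) (N , ψ≤N) = M + N , λ h ∣h∣≤1 → ∣∣≤-+ (φ≤M h ∣h∣≤1) (ψ≤N h ∣h∣≤1)

  bounded-* : ∀ {φ ψ} → Bounded φ → Bounded ψ → Bounded (λ h → φ h * ψ h)
  bounded-* (M , φ≤M) (N , ψ≤N) = M * N , λ h ∣h∣≤1 → ∣∣≤-* (φ≤M h ∣h∣≤1) (ψ≤N h ∣h∣≤1)

  Radius : Carrier → Set ℓ
  Radius η = 0# < η × η ≤ 1#

  -- With `φ` bounded by `M` the value is at least `a - η * M`. For `η = a / (a + M + 1)` this lower
  -- bound is exactly `(1 + a) * η`, which is positive.
  stays-positive : ∀ {a φ} → 0# < a → Bounded φ →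
                   ∃ λ η → Radius η × (∀ h → ∣ h ∣≤ η → 0# < a + h * φ h)
  stays-positive {a} {φ} 0<a (M , φ≤M) = η , (0<η , η≤1) , positive
    where
    open import Relation.Binary.Reasoning.Setoid setoid
    0≤M : 0# ≤ M
    0≤M = ∣∣≤-nonneg (φ≤M 0# (∣0∣≤ 0≤1))
    -- The summand `a` in `e` guarantees `η ≤ 1`, as the bound on `φ` is only known on [-1, 1].
    e η : Carrier
    e = a + (M + 1#)
    η = a * inv e
    0<e : 0# < e
    0<e = 0<+ 0<a (+-nonneg 0≤M 0≤1)
    0<η : 0# < η
    0<η = 0<* 0<a (0<inv 0<e)
    eη≈a : e * η ≈ a
    eη≈a = trans (solve 3 (λ e a i → e :* (a :* i) := a :* (e :* i)) refl e a (inv e))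
      (trans (*-congˡ (*-inverseʳ (0<⇒≉0 0<e))) (*-identityʳ a))
    η≤1 : η ≤ 1#
    η≤1 = *-cancelˡ-≤ 0<e (≤-resp (sym eη≈a) (sym (*-identityʳ e)) (x≤x+d a (+-nonneg 0≤M 0≤1)))
    positive : ∀ h → ∣ h ∣≤ η → 0# < a + h * φ h
    positive h ∣h∣≤η = <-resp refl split (0<+ (0<* (0<+ 0<1 (proj₁ 0<a)) 0<η) 0≤slack)
      where
      slack : Carrier
      slack = η * M + h * φ h
      0≤slack : 0# ≤ slack
      0≤slack = ≤-respʳ-≈ (+-congˡ (-‿involutive _))
        (≤⇒0≤- (proj₂ (∣∣≤-* ∣h∣≤η (φ≤M h (∣∣≤-trans ∣h∣≤η η≤1)))))
      split : (1# + a) * η + slack ≈ a + h * φ h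
      split = begin
        (1# + a) * η + (η * M + h * φ h)
          ≈⟨ solve 4 (λ a η M z → (con 1 :+ a) :* η :+ (η :* M :+ z)
               := (a :+ (M :+ con 1)) :* η :+ z) refl a η M (h * φ h) ⟩
        e * η + h * φ h
          ≈⟨ +-congʳ eη≈a ⟩
        a + h * φ h ∎

-- Uniqueness of dimension for trivial spaces and lines.

module Dimension {ℓ} (R : Reals ℓ) {n} (V : (Fin n → Reals.Carrier R) → Set ℓ) where
  open Reals R hiding (zero)
  open Spectral R
  open OrderedField R
  open FiniteSum commutativeSemiring
  open import Relation.Binary.Reasoning.Setoid setoid

  dimension-zero : ∀ {m} {b : Fin m → Fin n → Carrier} → IsBasis V b →
    (∀ v → V v → ∀ i → v i ≈ 0#) → m ≡ 0
  dimension-zero {zero}      basis V≈0 = ≡.refl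
  dimension-zero {suc m} {b} basis V≈0 = ⊥-elim (1≉0 (independent (λ _ → 1#)
    (λ i → sum-zero _ λ j → *≈0ʳ 1# (V≈0 (b j) (member j) i)) zero))
    where open IsBasis basis

  -- Two basis vectors `s w` and `t w` satisfy the relation with coefficients `t` and `- s`.
  -- Independence gives `s ≈ 0`, so the first basis vector vanishes, which contradicts independence
  -- once more.
  dimension-one : ∀ {m} {b : Fin m → Fin n → Carrier} → IsBasis V b →
    ∀ {w} → V w → ∀ {i₀} → ¬ (w i₀ ≈ 0#) → (∀ v → V v → ∃ λ c → ∀ i → v i ≈ c * w i) → m ≡ 1
  dimension-one {zero} basis w∈V {i₀} w≉0 _ =
    ⊥-elim (w≉0 (proj₂ (IsBasis.spanning basis _ w∈V) i₀))
  dimension-one {suc zero} _ _ _ _ = ≡.refl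
  dimension-one {suc (suc m)} {b} basis {w} w∈V w≉0 line = ⊥-elim (1≉0 (independent e₀ e₀-zero zero))
    where
    open IsBasis basis
    s t : Carrier
    s = proj₁ (line (b zero) (member zero))
    t = proj₁ (line (b (suc zero)) (member (suc zero)))
    b₀≈ : ∀ i → b zero i ≈ s * w i
    b₀≈ = proj₂ (line (b zero) (member zero))
    b₁≈ : ∀ i → b (suc zero) i ≈ t * w i
    b₁≈ = proj₂ (line (b (suc zero)) (member (suc zero)))
    relation e₀ : Fin (suc (suc m)) → Carrier
    relation zero          = t
    relation (suc zero)    = - s
    relation (suc (suc _)) = 0#
    e₀ zero    = 1#
    e₀ (suc _) = 0#
    relation-zero : ∀ i → linearCombination relation b i ≈ 0#
    relation-zero i = begin
      t * b zero i + (- s * b (suc zero) i + sum (λ j → 0# * b (suc (suc j)) i))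
        ≈⟨ +-cong (*-congˡ (b₀≈ i)) (+-cong (*-congˡ (b₁≈ i)) (sum-zero _ λ j → zeroˡ (b (suc (suc j)) i))) ⟩
      t * (s * w i) + (- s * (t * w i) + 0#)
        ≈⟨ solve 4 (λ t s ns w → t :* (s :* w) :+ (ns :* (t :* w) :+ con 0) := (s :+ ns) :* (t :* w))
             refl t s (- s) (w i) ⟩
      (s + - s) * (t * w i)
        ≈⟨ *≈0ˡ _ (-‿inverseʳ s) ⟩
      0# ∎
    s≈0 : s ≈ 0#
    s≈0 = trans (sym (-‿involutive s))
      (trans (-‿cong (independent relation relation-zero (suc zero))) -0#≈0#)
    e₀-zero : ∀ i → linearCombination e₀ b i ≈ 0#
    e₀-zero i = +≈0 (*≈0ʳ 1# (trans (b₀≈ i) (*≈0ˡ (w i) s≈0)))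
      (sum-zero _ λ j → zeroˡ (b (suc j) i))

-- Tridiagonal matrices.

module Tridiagonal {ℓ} (R : Reals ℓ) (D b : ℕ → Reals.Carrier R) where
  open Reals R hiding (zero)
  open Spectral R
  open OrderedField R
  open FiniteSum commutativeSemiring
  open import Relation.Binary.Reasoning.Setoid setoid

  -- The entry (s - 1, s) is b s.
  tridiagonal : ℕ → ℕ → Carrier
  tridiagonal s t = ind (s ℕ.≟ t) * D s + (ind (suc s ℕ.≟ t) * b t + ind (s ℕ.≟ suc t) * b s)

  IsTridiagonal : ∀ {j} → Matrix j j → Set ℓ
  IsTridiagonal M = ∀ p q → M p q ≈ tridiagonal (suc (toℕ p)) (suc (toℕ q))

  -- Coordinates numbered from 1, and extended by zero.
  extend : ∀ {j} → (Fin j → Carrier) → ℕ → Carrier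
  extend v s = sum λ q → ind (s ℕ.≟ suc (toℕ q)) * v q

  extend-suc : ∀ {j} (v : Fin j → Carrier) q → extend v (suc (toℕ q)) ≈ v q
  extend-suc v q = sum-only (λ q′ → suc (toℕ q) ℕ.≟ suc (toℕ q′)) v ≡.refl
    λ q′ eq → ≡.sym (Fin.toℕ-injective (ℕ.suc-injective eq))

  extend-zero : ∀ {j} (v : Fin j → Carrier) → extend v 0 ≈ 0#
  extend-zero v = sum-none (λ q → 0 ℕ.≟ suc (toℕ q)) v λ q ()

  extend-beyond : ∀ {j} (v : Fin j → Carrier) {s} → j ℕ.< s → extend v s ≈ 0#
  extend-beyond v {s} j<s = sum-none (λ q → s ℕ.≟ suc (toℕ q)) v
    λ { q ≡.refl → ℕ.<⇒≱ j<s (Fin.toℕ<n q) }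

  -- Extension by zero lets the first and the last row, which have one neighbour fewer, obey the
  -- same three-term formula as the others.
  tridiagonal-*ᵥ : ∀ {j} {M : Matrix j j} → IsTridiagonal M → ∀ v p → let s = suc (toℕ p) in
    (M *ᵥ v) p ≈ D s * extend v s + (b (suc s) * extend v (suc s) + b s * extend v (toℕ p))
  tridiagonal-*ᵥ {j} {M} tri v p = begin
    sum (λ q → M p q * v q)
      ≈⟨ sum-cong-≋ (λ q → trans (*-congʳ (tri p q)) (term q)) ⟩
    sum (λ q → D s * diag q + (b (suc s) * upper q + b s * lower q))
      ≈⟨ ∑-distrib-+ (λ q → D s * diag q) _ ⟩
    sum (λ q → D s * diag q) + sum (λ q → b (suc s) * upper q + b s * lower q)
      ≈⟨ +-cong (sum-*ˡ (D s) diag) (trans (∑-distrib-+ (λ q → b (suc s) * upper q) _)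
           (+-cong (sum-*ˡ (b (suc s)) upper) (sum-*ˡ (b s) lower))) ⟩
    D s * extend v s + (b (suc s) * extend v (suc s) + b s * extend v (toℕ p)) ∎
    where
    s : ℕ
    s = suc (toℕ p)
    diag upper lower : Fin j → Carrier
    diag  q = ind (s ℕ.≟ suc (toℕ q)) * v q
    upper q = ind (suc s ℕ.≟ suc (toℕ q)) * v q
    lower q = ind (toℕ p ℕ.≟ suc (toℕ q)) * v q
    term : ∀ q → tridiagonal s (suc (toℕ q)) * v q
                 ≈ D s * diag q + (b (suc s) * upper q + b s * lower q)
    term q = begin
      (ind s≟t * D s + (ind 1+s≟t * b t + ind s≟1+t * b s)) * v q
        ≈⟨ *-congʳ (+-congˡ (+-cong (ind-cong 1+s≟t λ eq → reflexive (≡.cong b (≡.sym eq)))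
             (*-congʳ (ind-⇔ s≟1+t (toℕ p ℕ.≟ t) ℕ.suc-injective (≡.cong suc))))) ⟩
      (ind s≟t * D s + (ind 1+s≟t * b (suc s) + ind (toℕ p ℕ.≟ t) * b s)) * v q
        ≈⟨ distribute (ind s≟t) (D s) (ind 1+s≟t * b (suc s) + ind (toℕ p ℕ.≟ t) * b s) (v q) ⟩
      D s * (ind s≟t * v q) + (ind 1+s≟t * b (suc s) + ind (toℕ p ℕ.≟ t) * b s) * v q
        ≈⟨ +-congˡ (trans (distribute (ind 1+s≟t) (b (suc s)) (ind (toℕ p ℕ.≟ t) * b s) (v q))
             (+-congˡ (rotate (ind (toℕ p ℕ.≟ t)) (b s) (v q)))) ⟩
      D s * (ind s≟t * v q) + (b (suc s) * (ind 1+s≟t * v q) + b s * (ind (toℕ p ℕ.≟ t) * v q)) ∎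
      where
      t : ℕ
      t = suc (toℕ q)
      s≟t   = s ℕ.≟ t
      1+s≟t = suc s ℕ.≟ t
      s≟1+t = s ℕ.≟ suc t
      distribute : ∀ i d y v → (i * d + y) * v ≈ d * (i * v) + y * v
      distribute = solve 4 (λ i d y v → (i :* d :+ y) :* v := d :* (i :* v) :+ y :* v) refl
      rotate : ∀ i d v → i * d * v ≈ d * (i * v)
      rotate = solve 3 (λ i d v → i :* d :* v := d :* (i :* v)) refl

-- The three-term recurrence and its largest root.

-- f x s is, up to normalisation, the characteristic polynomial at x of the
-- leading (s - 1) × (s - 1) submatrix of a tridiagonal matrix.
module ThreeTerm {ℓ} (R : Reals ℓ) (β : Reals.Carrier R) (0<β : Reals._<_ R (Reals.0# R) β)
                 (D μ : ℕ → Reals.Carrier R) where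
  open Reals R hiding (zero)
  open OrderedField R
  open BoundedFunctions R
  open import Relation.Binary.Reasoning.Setoid setoid

  β≉0 : ¬ (β ≈ 0#)
  β≉0 = 0<⇒≉0 0<β

  f : Carrier → ℕ → Carrier
  f x zero          = 0#
  f x (suc zero)    = 1#
  f x (suc (suc s)) = inv β * ((x + - D (suc s)) * f x (suc s)) + - μ (suc s) * f x s

  recurrence : ∀ x s → D (suc s) * f x (suc s) + β * (f x (suc (suc s)) + μ (suc s) * f x s)
                       ≈ x * f x (suc s)
  recurrence x s = begin
    d * f₁ + β * ((inv β * ((x + - d) * f₁) + - m * f₀) + m * f₀)
      ≈⟨ +-congˡ (*-congˡ (trans (+-assoc _ _ _) (trans (+-congˡ -m+m≈0) (+-identityʳ _)))) ⟩
    d * f₁ + β * (inv β * ((x + - d) * f₁))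
      ≈⟨ +-congˡ (x*[inv-x*y]≈y _ β≉0) ⟩
    d * f₁ + (x + - d) * f₁
      ≈⟨ distribʳ f₁ d _ ⟨
    (d + (x + - d)) * f₁
      ≈⟨ *-congʳ (x+[y-x]≈y d x) ⟩
    x * f₁ ∎
    where
    d  = D (suc s)
    m  = μ (suc s)
    f₁ = f x (suc s)
    f₀ = f x s
    -m+m≈0 : - m * f₀ + m * f₀ ≈ 0#
    -m+m≈0 = trans (sym (distribʳ f₀ (- m) m)) (*≈0ˡ f₀ (-‿inverseˡ m))

  f-cong : ∀ {x y} s → x ≈ y → f x s ≈ f y s
  f-cong zero          x≈y = refl
  f-cong (suc zero)    x≈y = refl
  f-cong (suc (suc s)) x≈y =
    +-cong (*-congˡ (*-cong (+-congʳ x≈y) (f-cong (suc s) x≈y))) (*-congˡ (f-cong s x≈y))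

  module _ (ρ : Carrier) where
    -- The difference quotient of `f` at `ρ` with increment `h`, obtained by expanding the
    -- recurrence so that no division by `h` occurs. It is a polynomial in `h`, hence bounded on
    -- [-1, 1].
    q : ℕ → Carrier → Carrier
    q zero          h = 0#
    q (suc zero)    h = 0#
    q (suc (suc s)) h =
      inv β * ((ρ + h + - D (suc s)) * q (suc s) h + f ρ (suc s)) + - μ (suc s) * q s h

    f-expansion : ∀ s h → f (ρ + h) s ≈ f ρ s + h * q s h
    f-expansion zero       h = sym (+≈0 refl (zeroʳ h))
    f-expansion (suc zero) h = sym (trans (+-congˡ (zeroʳ h)) (+-identityʳ 1#))
    f-expansion (suc (suc s)) h = begin
      inv β * ((ρ + h + - d) * f (ρ + h) (suc s)) + - m * f (ρ + h) s
        ≈⟨ +-cong (*-congˡ (*-congˡ (f-expansion (suc s) h))) (*-congˡ (f-expansion s h)) ⟩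
      inv β * ((ρ + h + - d) * (f₁ + h * q₁)) + - m * (f₀ + h * q₀)
        ≈⟨ +-cong (*-congˡ (trans (*-congʳ ρ+h-d) (product (ρ + - d) h f₁ q₁))) (scale (- m) f₀ h q₀) ⟩
      inv β * ((ρ + - d) * f₁ + h * ((ρ + - d + h) * q₁ + f₁)) + (- m * f₀ + h * (- m * q₀))
        ≈⟨ +-congʳ (*-congˡ (+-congˡ (*-congˡ (+-congʳ (*-congʳ ρ+h-d))))) ⟨
      inv β * ((ρ + - d) * f₁ + h * ((ρ + h + - d) * q₁ + f₁)) + (- m * f₀ + h * (- m * q₀))
        ≈⟨ +-congʳ (scale (inv β) _ h _) ⟩
      (inv β * ((ρ + - d) * f₁) + h * (inv β * ((ρ + h + - d) * q₁ + f₁))) + (- m * f₀ + h * (- m * q₀))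
        ≈⟨ merge _ _ _ _ h ⟩
      (inv β * ((ρ + - d) * f₁) + - m * f₀) + h * (inv β * ((ρ + h + - d) * q₁ + f₁) + - m * q₀) ∎
      where
      d  = D (suc s)
      m  = μ (suc s)
      f₁ = f ρ (suc s)
      q₁ = q (suc s) h
      f₀ = f ρ s
      q₀ = q s h
      ρ+h-d : ρ + h + - d ≈ ρ + - d + h
      ρ+h-d = trans (+-assoc _ _ _) (trans (+-congˡ (+-comm _ _)) (sym (+-assoc _ _ _)))
      product : ∀ e h a b → (e + h) * (a + h * b) ≈ e * a + h * ((e + h) * b + a)
      product = solve 4 (λ e h a b → (e :+ h) :* (a :+ h :* b) := e :* a :+ h :* ((e :+ h) :* b :+ a)) refl
      scale : ∀ c a h b → c * (a + h * b) ≈ c * a + h * (c * b)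
      scale = solve 4 (λ c a h b → c :* (a :+ h :* b) := c :* a :+ h :* (c :* b)) refl
      merge : ∀ a b a′ b′ h → (a + h * b) + (a′ + h * b′) ≈ (a + a′) + h * (b + b′)
      merge = solve 5 (λ a b a′ b′ h → (a :+ h :* b) :+ (a′ :+ h :* b′) := (a :+ a′) :+ h :* (b :+ b′)) refl

    q-bounded : ∀ s → Bounded (q s)
    q-bounded zero          = bounded-const 0#
    q-bounded (suc zero)    = bounded-const 0#
    q-bounded (suc (suc s)) = bounded-+
      (bounded-* (bounded-const _) (bounded-+
        (bounded-* (bounded-+ (bounded-+ (bounded-const _) bounded-id) (bounded-const _))
                   (q-bounded (suc s)))
        (bounded-const _)))
      (bounded-* (bounded-const _) (q-bounded s))

  AllPositive : ℕ → Carrier → Set ℓ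
  AllPositive N x = ∀ i → i ℕ.≤ N → 0# < f x (suc i)

  allPositive-near : ∀ ρ N → AllPositive N ρ →
                     ∃ λ η → Radius η × (∀ h → ∣ h ∣≤ η → AllPositive N (ρ + h))
  allPositive-near ρ zero    _   = 1# , (0<1 , ≤-refl) , λ { h _ zero _ → 0<1 }
  allPositive-near ρ (suc N) pos = combine
    (allPositive-near ρ N λ i i≤N → pos i (ℕ.m≤n⇒m≤1+n i≤N))
    (stays-positive (pos (suc N) ℕ.≤-refl) (q-bounded ρ (suc (suc N))))
    where
    a : Carrier
    a = f ρ (suc (suc N))
    combine :
      (∃ λ η → Radius η × (∀ h → ∣ h ∣≤ η → AllPositive N (ρ + h))) →
      (∃ λ η → Radius η × (∀ h → ∣ h ∣≤ η → 0# < a + h * q ρ (suc (suc N)) h)) →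
      ∃ λ η → Radius η × (∀ h → ∣ h ∣≤ η → AllPositive (suc N) (ρ + h))
    combine (η₁ , radius₁ , near₁) (η₂ , radius₂ , near₂) = choose (total η₁ η₂)
      where
      extend : ∀ h → ∣ h ∣≤ η₁ → ∣ h ∣≤ η₂ → AllPositive (suc N) (ρ + h)
      extend h ∣h∣≤η₁ ∣h∣≤η₂ i i≤ with ℕ.m≤n⇒m<n∨m≡n i≤
      ... | inj₁ (s≤s i≤N) = near₁ h ∣h∣≤η₁ i i≤N
      ... | inj₂ ≡.refl    = <-resp refl (sym (f-expansion ρ (suc (suc N)) h)) (near₂ h ∣h∣≤η₂)
      choose : η₁ ≤ η₂ ∨ η₂ ≤ η₁ → ∃ λ η → Radius η × (∀ h → ∣ h ∣≤ η → AllPositive (suc N) (ρ + h))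
      choose (inj₁ η₁≤η₂) = η₁ , radius₁ , λ h ∣h∣≤η₁ → extend h ∣h∣≤η₁ (∣∣≤-trans ∣h∣≤η₁ η₁≤η₂)
      choose (inj₂ η₂≤η₁) = η₂ , radius₂ , λ h ∣h∣≤η₂ → extend h (∣∣≤-trans ∣h∣≤η₂ η₂≤η₁) ∣h∣≤η₂

  module _ (μ≥0 : ∀ s → 0# ≤ μ s) where
    Increasing : ℕ → Carrier → Set ℓ
    Increasing N x = ∀ i → i ℕ.≤ N → f x i ≤ f x (suc i) × 0# < f x (suc i)

    -- Writing f₀, f₁, f₂ for consecutive values, the recurrence reads `β (f₂ + μ f₀) = (x - D) f₁`,
    -- and the bound on `x` makes the right side at least `β (f₁ + μ f₁)`. Then
    -- `f₂ ≥ f₁ + μ (f₁ - f₀) ≥ f₁`.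
    increasing-step : ∀ s x → D (suc s) + β * (1# + μ (suc s)) ≤ x →
      f x s ≤ f x (suc s) → 0# < f x (suc s) → f x (suc s) ≤ f x (suc (suc s))
    increasing-step s x M≤x f₀≤f₁ 0<f₁ = +-cancelˡ-≤ (μ (suc s) * f x s)
      (≤-trans (≤-respˡ-≈ (+-comm _ _) (+-monoʳ-≤ (f x (suc s)) (*-monoˡ-≤ (μ≥0 (suc s)) f₀≤f₁)))
               (≤-respʳ-≈ (+-comm _ _) (*-cancelˡ-≤ 0<β (+-cancelˡ-≤ (D (suc s) * f x (suc s))
                 (≤-resp expand (sym (recurrence x s)) (*-monoʳ-≤ (proj₁ 0<f₁) M≤x))))))
      where
      expand : (D (suc s) + β * (1# + μ (suc s))) * f x (suc s)
               ≈ D (suc s) * f x (suc s) + β * (f x (suc s) + μ (suc s) * f x (suc s))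
      expand = solve 4 (λ d β m f₁ → (d :+ β :* (con 1 :+ m)) :* f₁
                 := d :* f₁ :+ β :* (f₁ :+ m :* f₁)) refl (D (suc s)) β (μ (suc s)) (f x (suc s))

    -- Only positivity for large `x` is wanted, as an upper bound for the points where some value is
    -- nonpositive. Monotonicity is carried along because the induction step needs it.
    eventually-increasing : ∀ N → ∃ λ M → ∀ x → M ≤ x → Increasing N x
    eventually-increasing zero = 0# , λ { x _ zero _ → 0≤1 , 0<1 }
    eventually-increasing (suc N) with eventually-increasing N
    ... | M , M≤⇒ = larger , λ x larger≤x → extend x (≤-trans M≤larger larger≤x) (≤-trans M′≤larger larger≤x)
      where
      M′ : Carrier
      M′ = D (suc N) + β * (1# + μ (suc N))
      max : ∃ λ z → M ≤ z × M′ ≤ z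
      max with total M M′
      ... | inj₁ M≤M′ = M′ , M≤M′ , ≤-refl
      ... | inj₂ M′≤M = M , ≤-refl , M′≤M
      larger : Carrier
      larger = proj₁ max
      M≤larger : M ≤ larger
      M≤larger = proj₁ (proj₂ max)
      M′≤larger : M′ ≤ larger
      M′≤larger = proj₂ (proj₂ max)
      extend : ∀ x → M ≤ x → M′ ≤ x → Increasing (suc N) x
      extend x M≤x M′≤x i i≤ with ℕ.m≤n⇒m<n∨m≡n i≤
      ... | inj₁ (s≤s i≤N) = M≤⇒ x M≤x i i≤N
      ... | inj₂ ≡.refl with M≤⇒ x M≤x N ℕ.≤-refl
      ...   | f₀≤f₁ , 0<f₁ = f₁≤f₂ , <-≤-trans 0<f₁ f₁≤f₂
        where f₁≤f₂ = increasing-step N x M′≤x f₀≤f₁ 0<f₁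

    -- The supremum ρ of the points at which one of f _ 2, …, f _ (k + 1) is
    -- nonpositive.  By continuity they are all nonnegative at ρ, and the
    -- recurrence prevents any but the last from vanishing there.
    largest-root : ∀ k → 1 ℕ.≤ k → (∀ i → 1 ℕ.≤ i → i ℕ.< k → 0# < μ (suc i)) →
      ∃ λ ρ → (∀ i → i ℕ.< k → 0# < f ρ (suc i)) × f ρ (suc k) ≈ 0#
    largest-root k@(suc k-1) 1≤k μ>0 = ρ , positive , f-vanishes
      where
      S : Carrier → Set ℓ
      S x = ∃ λ i → i ℕ.≤ k × f x (suc i) ≤ 0#

      positive⇒∉S : ∀ {x} → AllPositive k x → ¬ S x
      positive⇒∉S pos (i , i≤k , f≤0) = <⇒≱ (pos i i≤k) f≤0

      S-resp : ∀ {x y} → x ≈ y → S x → S y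
      S-resp x≈y (i , i≤k , f≤0) = i , i≤k , ≤-respˡ-≈ (f-cong (suc i) x≈y) f≤0

      -- At `x = D 1` the second value is `inv β * (D 1 - D 1) - μ 1 * 0`, which vanishes.
      D₁∈S : S (D 1)
      D₁∈S = 1 , 1≤k , ≤-reflexive (+≈0
        (*≈0ʳ (inv β) (*≈0ˡ 1# (-‿inverseʳ (D 1)))) (zeroʳ (- μ 1)))

      S-bounded : ∃ (IsUpperBound S)
      S-bounded with eventually-increasing k
      ... | M , M≤⇒ = M , upper
        where
        upper : IsUpperBound S M
        upper x x∈S with total x M
        ... | inj₁ x≤M = x≤M
        ... | inj₂ M≤x = ⊥-elim (positive⇒∉S (λ i i≤k → proj₂ (M≤⇒ x M≤x i i≤k)) x∈S)

      supremum : ∃ (IsSupremum S)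
      supremum = completeness S (D 1 , D₁∈S) S-bounded

      ρ : Carrier
      ρ = proj₁ supremum

      ρ-upper : IsUpperBound S ρ
      ρ-upper = proj₁ (proj₂ supremum)

      -- Positivity at `ρ` would persist within some distance `η`, and no point of `S` exceeds `ρ`;
      -- so `ρ + - η` would be an upper bound smaller than the supremum.
      ¬positive : ¬ AllPositive k ρ
      ¬positive pos = refute (allPositive-near ρ k pos)
        where
        refute : ¬ (∃ λ η → Radius η × (∀ h → ∣ h ∣≤ η → AllPositive k (ρ + h)))
        refute (η , (0<η , _) , near) = <⇒≱ 0<η (≤-resp (-‿involutive η) -0#≈0# (neg-anti
          (+-cancelˡ-≤ ρ (≤-respˡ-≈ (sym (+-identityʳ ρ)) (proj₂ (proj₂ supremum) _ ρ-η-upper)))))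
          where
          ρ-η-upper : IsUpperBound S (ρ + - η)
          ρ-η-upper x x∈S with total x (ρ + - η)
          ... | inj₁ x≤ρ-η = x≤ρ-η
          ... | inj₂ ρ-η≤x = ⊥-elim (positive⇒∉S (near h (h≤η , -h≤η)) (S-resp (sym (x+[y-x]≈y ρ x)) x∈S))
            where
            h : Carrier
            h = x + - ρ
            h≤η : h ≤ η
            h≤η = ≤-trans (+-cancelˡ-≤ ρ (≤-resp (sym (x+[y-x]≈y ρ x)) (sym (+-identityʳ ρ)) (ρ-upper x x∈S)))
                          (proj₁ 0<η)
            -h≤η : - h ≤ η
            -h≤η = ≤-respʳ-≈ (-‿involutive η)
              (neg-anti (+-cancelˡ-≤ ρ (≤-respʳ-≈ (sym (x+[y-x]≈y ρ x)) ρ-η≤x)))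

      -- A negative value would persist up to some `ρ + η`, putting a point beyond `ρ` into `S`.
      ¬negative : ∀ i → i ℕ.≤ k → ¬ (f ρ (suc i) < 0#)
      ¬negative i i≤k f<0 = refute
        (stays-positive (<-resp refl (+-identityˡ _) (<⇒0<- f<0)) (bounded-neg (q-bounded ρ (suc i))))
        where
        refute : ¬ (∃ λ η → Radius η × (∀ h → ∣ h ∣≤ η → 0# < - f ρ (suc i) + h * - q ρ (suc i) h))
        refute (η , (0<η , _) , near) = <⇒≱ 0<η (+-cancelˡ-≤ ρ
          (≤-respʳ-≈ (sym (+-identityʳ ρ)) (ρ-upper (ρ + η) (i , i≤k , f[ρ+η]≤0))))
          where
          -[f+hq] : - f ρ (suc i) + η * - q ρ (suc i) η ≈ - f (ρ + η) (suc i)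
          -[f+hq] = trans (+-congˡ (sym (-‿distribʳ-* η _)))
            (trans (-‿+-comm _ _) (-‿cong (sym (f-expansion ρ (suc i) η))))
          f[ρ+η]≤0 : f (ρ + η) (suc i) ≤ 0#
          f[ρ+η]≤0 = ≤-resp (-‿involutive _) -0#≈0#
            (neg-anti (proj₁ (<-resp refl -[f+hq] (near η (∣∣≤-of-nonneg (proj₁ 0<η))))))

      nonneg : ∀ i → i ℕ.≤ k → 0# ≤ f ρ (suc i)
      nonneg i i≤k with ≤⊎> 0# (f ρ (suc i))
      ... | inj₁ 0≤f = 0≤f
      ... | inj₂ f<0 = ⊥-elim (¬negative i i≤k f<0)

      positive : ∀ i → i ℕ.< k → 0# < f ρ (suc i)
      positive zero    _   = 0<1
      -- If the middle one of three consecutive values vanishes, the recurrence leaves `f ρ (3 + i)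
      -- + μ (2 + i) * f ρ (1 + i) = 0`. The first term is nonnegative and the second positive by
      -- induction.
      positive (suc i) i<k = nonneg (suc i) (ℕ.<⇒≤ i<k) , λ 0≈f₁ →
        0<⇒≉0 (0<+ (0<* (μ>0 (suc i) (s≤s z≤n) i<k) (positive i (ℕ.<⇒≤ i<k))) (nonneg (suc (suc i)) i<k))
          (trans (+-comm _ _) (*≈0⇒≈0 β≉0 (begin
            β * (f ρ (3 ℕ.+ i) + μ (2 ℕ.+ i) * f ρ (suc i))
              ≈⟨ +-identityˡ _ ⟨
            0# + β * (f ρ (3 ℕ.+ i) + μ (2 ℕ.+ i) * f ρ (suc i))
              ≈⟨ +-congʳ (*≈0ʳ _ (sym 0≈f₁)) ⟨
            D (2 ℕ.+ i) * f ρ (2 ℕ.+ i) + β * (f ρ (3 ℕ.+ i) + μ (2 ℕ.+ i) * f ρ (suc i))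
              ≈⟨ recurrence ρ (suc i) ⟩
            ρ * f ρ (2 ℕ.+ i)
              ≈⟨ *≈0ʳ ρ (sym 0≈f₁) ⟩
            0# ∎)))

      f-vanishes : f ρ (suc k) ≈ 0#
      f-vanishes with ≤⊎> (f ρ (suc k)) 0#
      ... | inj₁ f≤0 = antisym f≤0 (nonneg k ℕ.≤-refl)
      ... | inj₂ 0<f = ⊥-elim (¬positive all)
        where
        all : AllPositive k ρ
        all i i≤k with ℕ.m≤n⇒m<n∨m≡n i≤k
        ... | inj₁ i<k    = positive i i<k
        ... | inj₂ ≡.refl = 0<f

  -- Eigenspaces of the symmetric tridiagonal matrices.

  module Symmetric (b r : ℕ → Carrier) (k : ℕ)
    (b≈βr : ∀ s → b s ≈ β * r s) (r*r≈μ : ∀ s → r s * r s ≈ μ s)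
    (0<r : ∀ i → 1 ℕ.≤ i → i ℕ.< k → 0# < r (suc i)) where
    open Spectral R hiding (β; _⊎_)
    open Tridiagonal R D b

    -- Diagonal similarity turning the recurrence of f into that of a symmetric matrix.
    g : ℕ → Carrier
    g zero          = 1#
    g (suc zero)    = 1#
    g (suc (suc s)) = g (suc s) * inv (r (suc (suc s)))

    0<g : ∀ i → i ℕ.< k → 0# < g (suc i)
    0<g zero    _   = 0<1
    0<g (suc i) i<k = 0<* (0<g i (ℕ.<⇒≤ i<k)) (0<inv (0<r (suc i) (s≤s z≤n) i<k))

    r*g : ∀ i → suc i ℕ.< k → r (suc (suc i)) * g (suc (suc i)) ≈ g (suc i)
    r*g i i<k = trans (*-congˡ (*-comm _ _)) (x*[inv-x*y]≈y _ (0<⇒≉0 (0<r (suc i) (s≤s z≤n) i<k)))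

    b≉0 : ∀ i → suc i ℕ.< k → ¬ (b (suc (suc i)) ≈ 0#)
    b≉0 i i<k = 0<⇒≉0 (<-resp refl (sym (b≈βr _)) (0<* 0<β (0<r (suc i) (s≤s z≤n) i<k)))

    module _ (x : Carrier) where
      w : ℕ → Carrier
      w s = g s * f x s

      w-upper : ∀ i → suc i ℕ.< k → b (2 ℕ.+ i) * w (2 ℕ.+ i) ≈ g (suc i) * (β * f x (2 ℕ.+ i))
      w-upper i i<k = begin
        b (2 ℕ.+ i) * (g (2 ℕ.+ i) * f₂)      ≈⟨ *-congʳ (b≈βr _) ⟩
        β * r (2 ℕ.+ i) * (g (2 ℕ.+ i) * f₂)
          ≈⟨ solve 4 (λ β r g f → β :* r :* (g :* f) := (r :* g) :* (β :* f)) refl β _ _ f₂ ⟩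
        r (2 ℕ.+ i) * g (2 ℕ.+ i) * (β * f₂)  ≈⟨ *-congʳ (r*g i i<k) ⟩
        g (suc i) * (β * f₂)                  ∎
        where f₂ = f x (2 ℕ.+ i)

      w-lower : ∀ i → i ℕ.< k → b (suc i) * w i ≈ g (suc i) * (β * (μ (suc i) * f x i))
      w-lower zero    _   = trans (*≈0ʳ _ (zeroʳ _)) (sym (*≈0ʳ _ (*≈0ʳ β (zeroʳ _))))
      w-lower (suc i) i<k = begin
        b (2 ℕ.+ i) * (g (suc i) * f₁)
          ≈⟨ *-cong (b≈βr _) (*-congʳ (sym (r*g i i<k))) ⟩
        β * r₂ * (r₂ * g₂ * f₁)
          ≈⟨ solve 4 (λ β r g f → β :* r :* (r :* g :* f) := g :* (β :* (r :* r :* f))) refl β r₂ g₂ f₁ ⟩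
        g₂ * (β * (r₂ * r₂ * f₁))
          ≈⟨ *-congˡ (*-congˡ (*-congʳ (r*r≈μ _))) ⟩
        g₂ * (β * (μ (2 ℕ.+ i) * f₁)) ∎
        where
        f₁ = f x (suc i)
        r₂ = r (2 ℕ.+ i)
        g₂ = g (2 ℕ.+ i)

      -- The upper term is kept as `g (suc i) * (β * f x (2 + i))` instead of `b * w`: turning one
      -- into the other needs `r (2 + i)` to be invertible, which is unknown for `i + 1 = k`. In
      -- this form the identity covers the last row too.
      w-recurrence : ∀ i → i ℕ.< k →
        D (suc i) * w (suc i) + (g (suc i) * (β * f x (2 ℕ.+ i)) + b (suc i) * w i) ≈ x * w (suc i)
      w-recurrence i i<k = begin
        D (suc i) * (g₁ * f₁) + (g₁ * (β * f₂) + b (suc i) * w i)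
          ≈⟨ +-cong (solve 3 (λ d g f → d :* (g :* f) := g :* (d :* f)) refl (D (suc i)) g₁ f₁)
                    (+-congˡ (w-lower i i<k)) ⟩
        g₁ * (D (suc i) * f₁) + (g₁ * (β * f₂) + g₁ * (β * (μ (suc i) * f x i)))
          ≈⟨ solve 5 (λ g d β f m → g :* d :+ (g :* (β :* f) :+ g :* (β :* m)) := g :* (d :+ β :* (f :+ m)))
               refl g₁ (D (suc i) * f₁) β f₂ (μ (suc i) * f x i) ⟩
        g₁ * (D (suc i) * f₁ + β * (f₂ + μ (suc i) * f x i))
          ≈⟨ *-congˡ (recurrence x i) ⟩
        g₁ * (x * f₁)
          ≈⟨ solve 3 (λ g x f → g :* (x :* f) := x :* (g :* f)) refl g₁ x f₁ ⟩
        x * (g₁ * f₁) ∎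
        where
        g₁ = g (suc i)
        f₁ = f x (suc i)
        f₂ = f x (2 ℕ.+ i)

      module _ {j} (M : Matrix (suc j) (suc j)) (tri : IsTridiagonal M) (j<k : j ℕ.< k) where
        eigenvector : Fin (suc j) → Carrier
        eigenvector p = w (suc (toℕ p))

        extend-eigenvector : ∀ s → s ℕ.≤ suc j → extend eigenvector s ≈ w s
        extend-eigenvector zero    _   = trans (extend-zero eigenvector) (sym (zeroʳ 1#))
        extend-eigenvector (suc s) s≤j = ≡.subst (λ s → extend eigenvector (suc s) ≈ w (suc s))
          (Fin.toℕ-fromℕ< s≤j) (extend-suc eigenvector (fromℕ< s≤j))

        -- All rows but the last follow the recurrence as they stand. In the last row the next
        -- coordinate is absent, and `f x (2 + j) ≈ 0` says precisely that the recurrence has no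
        -- such term either.
        eigenvector∈Eigenspace : f x (2 ℕ.+ j) ≈ 0# → Eigenspace M x eigenvector
        eigenvector∈Eigenspace f≈0 p = trans (tridiagonal-*ᵥ tri eigenvector p)
          (trans (+-cong (*-congˡ (extend-suc eigenvector p))
            (+-cong (upper (ℕ.m≤n⇒m<n∨m≡n (ℕ.≤-pred (Fin.toℕ<n p))))
                    (*-congˡ (extend-eigenvector (toℕ p) (ℕ.<⇒≤ (Fin.toℕ<n p))))))
            (w-recurrence i (ℕ.<-≤-trans (Fin.toℕ<n p) j<k)))
          where
          i : ℕ
          i = toℕ p
          upper : (i ℕ.< j) ∨ (i ≡ j) →
                  b (2 ℕ.+ i) * extend eigenvector (2 ℕ.+ i) ≈ g (suc i) * (β * f x (2 ℕ.+ i))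
          upper (inj₁ i<j) = trans (*-congˡ (extend-eigenvector _ (s≤s i<j)))
            (w-upper i (ℕ.≤-<-trans i<j j<k))
          upper (inj₂ i≡j) = trans
            (*≈0ʳ _ (extend-beyond eigenvector (s≤s (s≤s (ℕ.≤-reflexive (≡.sym i≡j))))))
            (sym (*≈0ʳ _ (*≈0ʳ β (trans (reflexive (≡.cong (λ i → f x (2 ℕ.+ i)) i≡j)) f≈0))))

        module _ {v} (v-eigen : Eigenspace M x v) where
          V : ℕ → Carrier
          V = extend v

          c : Carrier
          c = V 1

          V-recurrence : ∀ i → i ℕ.≤ j → D (suc i) * V (suc i) + (b (2 ℕ.+ i) * V (2 ℕ.+ i) + b (suc i) * V i)
                                         ≈ x * V (suc i)
          V-recurrence i i≤j = ≡.subst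
            (λ i → D (suc i) * V (suc i) + (b (2 ℕ.+ i) * V (2 ℕ.+ i) + b (suc i) * V i) ≈ x * V (suc i))
            (Fin.toℕ-fromℕ< (s≤s i≤j))
            (trans (sym (tridiagonal-*ᵥ tri v _)) (trans (v-eigen _) (*-congˡ (sym (extend-suc v _)))))

          next : ∀ i → i ℕ.≤ j → V (suc i) ≈ c * w (suc i) → V i ≈ c * w i →
                 b (2 ℕ.+ i) * V (2 ℕ.+ i) ≈ c * (g (suc i) * (β * f x (2 ℕ.+ i)))
          next i i≤j V₁≈ V₀≈ = +-cancelʳ (D (suc i) * V (suc i) + b (suc i) * V i) _ _ (begin
            b (2 ℕ.+ i) * V (2 ℕ.+ i) + (D (suc i) * V (suc i) + b (suc i) * V i)
              ≈⟨ shuffle _ _ _ ⟩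
            D (suc i) * V (suc i) + (b (2 ℕ.+ i) * V (2 ℕ.+ i) + b (suc i) * V i)
              ≈⟨ V-recurrence i i≤j ⟩
            x * V (suc i)
              ≈⟨ *-congˡ V₁≈ ⟩
            x * (c * w (suc i))
              ≈⟨ solve 3 (λ x c w → x :* (c :* w) := c :* (x :* w)) refl x c (w (suc i)) ⟩
            c * (x * w (suc i))
              ≈⟨ *-congˡ (w-recurrence i (ℕ.≤-<-trans i≤j j<k)) ⟨
            c * (D (suc i) * w (suc i) + (u + b (suc i) * w i))
              ≈⟨ factor c (D (suc i)) (w (suc i)) u (b (suc i)) (w i) ⟩
            c * u + (D (suc i) * (c * w (suc i)) + b (suc i) * (c * w i))
              ≈⟨ +-congˡ (+-cong (*-congˡ (sym V₁≈)) (*-congˡ (sym V₀≈))) ⟩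
            c * u + (D (suc i) * V (suc i) + b (suc i) * V i) ∎)
            where
            u : Carrier
            u = g (suc i) * (β * f x (2 ℕ.+ i))
            shuffle : ∀ a d e → a + (d + e) ≈ d + (a + e)
            shuffle = solve 3 (λ a d e → a :+ (d :+ e) := d :+ (a :+ e)) refl
            factor : ∀ c d w₁ u b w₀ → c * (d * w₁ + (u + b * w₀)) ≈ c * u + (d * (c * w₁) + b * (c * w₀))
            factor = solve 6 (λ c d w₁ u b w₀ → c :* (d :* w₁ :+ (u :+ b :* w₀))
                               := c :* u :+ (d :* (c :* w₁) :+ b :* (c :* w₀))) refl

          -- Off-diagonal entries inside the matrix are nonzero, so each row can be solved for the
          -- next coordinate. Two consecutive coordinates are carried because the recurrence has
          -- order two.
          proportional : ∀ i → i ℕ.≤ j → V (suc i) ≈ c * w (suc i) × V i ≈ c * w i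
          proportional zero _ = sym (trans (*-congˡ (*-identityˡ 1#)) (*-identityʳ c)) ,
            trans (extend-zero v) (sym (*≈0ʳ c (zeroʳ 1#)))
          proportional (suc i) i<j with proportional i (ℕ.<⇒≤ i<j)
          ... | V₁≈ , V₀≈ = *-cancelˡ (b≉0 i i<k) (begin
            b (2 ℕ.+ i) * V (2 ℕ.+ i)                  ≈⟨ next i (ℕ.<⇒≤ i<j) V₁≈ V₀≈ ⟩
            c * (g (suc i) * (β * f x (2 ℕ.+ i)))      ≈⟨ *-congˡ (w-upper i i<k) ⟨
            c * (b (2 ℕ.+ i) * w (2 ℕ.+ i))
              ≈⟨ solve 3 (λ c b w → c :* (b :* w) := b :* (c :* w)) refl c _ (w (2 ℕ.+ i)) ⟩
            b (2 ℕ.+ i) * (c * w (2 ℕ.+ i)) ∎) , V₁≈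
            where i<k = ℕ.≤-<-trans i<j j<k

          v≈cw : ∀ p → v p ≈ c * eigenvector p
          v≈cw p = trans (sym (extend-suc v p)) (proj₁ (proportional (toℕ p) (ℕ.≤-pred (Fin.toℕ<n p))))

          -- The coordinate after the last is zero, so the last row reads
          -- `c * (g (suc j) * (β * f x (2 + j))) ≈ 0`, where only `c` can vanish.
          v≈0 : ¬ (f x (2 ℕ.+ j) ≈ 0#) → ∀ p → v p ≈ 0#
          v≈0 f≉0 p = trans (v≈cw p) (*≈0ˡ _ c≈0)
            where
            cu≈0 : c * (g (suc j) * (β * f x (2 ℕ.+ j))) ≈ 0#
            cu≈0 = trans (sym (next j ℕ.≤-refl (proj₁ (proportional j ℕ.≤-refl)) (proj₂ (proportional j ℕ.≤-refl))))
              (*≈0ʳ _ (extend-beyond v ℕ.≤-refl))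
            c≈0 : c ≈ 0#
            c≈0 with c ≟ 0#
            ... | yes c≈0 = c≈0
            ... | no  c≉0 = ⊥-elim (f≉0 (*≈0⇒≈0 β≉0 (*≈0⇒≈0 (0<⇒≉0 (0<g j j<k)) (*≈0⇒≈0 c≉0 cu≈0))))

        multiplicity-one : ∀ {m} → f x (2 ℕ.+ j) ≈ 0# → HasMultiplicity M x m → m ≡ 1
        multiplicity-one f≈0 (_ , basis) = Dimension.dimension-one R (Eigenspace M x) basis
          (eigenvector∈Eigenspace f≈0) {zero} (1≉0 ∘ trans (sym (*-identityˡ 1#)))
          λ v v-eigen → c v-eigen , v≈cw v-eigen

        multiplicity-zero : ∀ {m} → ¬ (f x (2 ℕ.+ j) ≈ 0#) → HasMultiplicity M x m → m ≡ 0
        multiplicity-zero f≉0 (_ , basis) = Dimension.dimension-zero R (Eigenspace M x) basis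
          λ v v-eigen → v≈0 v-eigen f≉0

module ℕ-Sum = FiniteSum ℕ.+-*-commutativeSemiring

-- Counting by sums of indicators.

module Counting where
  open ≡ using (refl; sym; trans; cong; subst)
  open ℕ-Sum

  count≡sum : ∀ {n} {P : Pred (Fin n) _} (P? : Decidable P) → count P? ≡ sum (ind ∘ P?)
  count≡sum P? = go id
    where
    go : ∀ {m} (f : Fin m → _) → length (filter P? (tabulate f)) ≡ sum (ind ∘ P? ∘ f)
    go {zero}  f = refl
    go {suc m} f with P? (f zero)
    ... | yes _ = cong suc (go (f ∘ suc))
    ... | no  _ = go (f ∘ suc)

  ≤-sum : ∀ {n} (g : Fin n → ℕ) i → g i ℕ.≤ sum g
  ≤-sum g zero    = ℕ.m≤m+n _ _
  ≤-sum g (suc i) = ℕ.≤-trans (≤-sum (g ∘ suc) i) (ℕ.m≤n+m _ _)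

  1≤sum-ind : ∀ {n p} {P : Pred (Fin n) p} (P? : Decidable P) {i} → P i → 1 ℕ.≤ sum (ind ∘ P?)
  1≤sum-ind P? {i} pi = subst (ℕ._≤ _) (ind-true (P? i) pi) (≤-sum (ind ∘ P?) i)

  sum-ind-zero : ∀ {n p} {P : Pred (Fin n) p} (P? : Decidable P) → (∀ i → ¬ P i) → sum (ind ∘ P?) ≡ 0
  sum-ind-zero P? none = sum-zero _ λ i → ind-false (P? i) (none i)

  sum-ind-one : ∀ {n p} {P : Pred (Fin n) p} (P? : Decidable P) {i} → P i → (∀ j → P j → j ≡ i) →
                sum (ind ∘ P?) ≡ 1
  sum-ind-one P? pi unique =
    trans (sum-cong-≋ λ i → sym (ℕ.*-identityʳ (ind (P? i)))) (sum-only P? (λ _ → 1) pi unique)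

  1≤sum-ind⇒∃ : ∀ {n p} {P : Pred (Fin n) p} (P? : Decidable P) → 1 ℕ.≤ sum (ind ∘ P?) → ∃ P
  1≤sum-ind⇒∃ P? 1≤sum with Fin.any? P?
  ... | yes ∃P = ∃P
  ... | no ¬∃P = ⊥-elim (ℕ.<⇒≢ 1≤sum (sym (sum-ind-zero P? λ i pi → ¬∃P (i , pi))))

-- Parents, children and heirs in a rooted tree.

module RootedTree {n} (G : SimpleGraph n) (isTree : SimpleGraph.IsTree G) (root : Fin n) (dist : Fin n → ℕ)
                  (isDistance : ∀ v → SimpleGraph.IsDistance G root v (dist v)) where
  open SimpleGraph G
  open ≡ using (refl; sym; trans; cong; subst)

  dist-root : dist root ≡ 0
  dist-root = ℕ.n≤0⇒n≡0 (proj₂ (isDistance root) ε)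

  dist≡0⇒root : ∀ {v} → dist v ≡ 0 → v ≡ root
  dist≡0⇒root {v} dist≡0 with isDistance v
  ... | (ε , _) , _ = refl
  ... | (_ ◅ _ , len) , _ = ⊥-elim (ℕ.1+n≢0 (trans len dist≡0))

  ~⇒dist≤ : ∀ {u v} → u ~ v → dist v ℕ.≤ suc (dist u)
  ~⇒dist≤ {u} {v} u~v with isDistance u
  ... | (w , len) , _ = ℕ.≤-trans (proj₂ (isDistance v) (w ◅◅ u~v ◅ ε))
                                  (ℕ.≤-reflexive (trans (length-snoc w) (cong suc len)))
    where
    length-snoc : ∀ {a} (w : Walk a u) → walkLength (w ◅◅ u~v ◅ ε) ≡ suc (walkLength w)
    length-snoc ε       = refl
    length-snoc (_ ◅ w) = cong suc (length-snoc w)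

  infix 4 _⟶_ _⟶?_
  _⟶_ : Fin n → Fin n → Set
  p ⟶ c = dist c ≡ suc (dist p) × p ~ c

  _⟶?_ : ∀ p c → Dec (p ⟶ c)
  p ⟶? c = (dist c ℕ.≟ suc (dist p)) ×-dec (p ~? c)

  unsnoc : ∀ {a v l} (w : Walk a v) → walkLength w ≡ suc l →
           ∃ λ u → u ~ v × ∃ λ (w′ : Walk a u) → walkLength w′ ≡ l
  unsnoc (e ◅ ε) refl = _ , e , ε , refl
  unsnoc (e ◅ w@(_ ◅ _)) refl with unsnoc w refl
  ... | u , u~v , w′ , len = u , u~v , e ◅ w′ , cong suc len

  parent : ∀ {v l} → dist v ≡ suc l → ∃ λ u → u ⟶ v × dist u ≡ l
  parent {v} {l} dist≡ with isDistance v
  ... | (w , len) , _ with unsnoc w (trans len dist≡)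
  ...   | u , u~v , w′ , len′ = u , (trans dist≡ (cong suc (sym dist-u)) , u~v) , dist-u
    where
    dist-u : dist u ≡ l
    dist-u = ℕ.≤-antisym (ℕ.≤-trans (proj₂ (isDistance u) w′) (ℕ.≤-reflexive len′))
                         (ℕ.≤-pred (ℕ.≤-trans (ℕ.≤-reflexive (sym dist≡)) (~⇒dist≤ u~v)))

  -- `below` is what keeps walks simple when an edge is put in front: a new first vertex at distance
  -- at least `dist u`, and different from `u`, cannot occur again. `length≡` permits comparing two
  -- descents by length.
  record Descent (u : Fin n) : Set where
    field
      walk      : Walk u root
      isPath    : IsPath walk
      rest      : List (Fin n)
      vertices≡ : vertices walk ≡ u ∷ rest
      below     : All (λ z → dist z ℕ.< dist u) rest
      length≡   : length rest ≡ dist u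

    length-vertices : length (vertices walk) ≡ suc (dist u)
    length-vertices = trans (cong length vertices≡) (cong suc length≡)

  descend : ∀ {p u} → p ⟶ u → Descent p → Descent u
  descend {p} {u} (dist-u , p~u) D = record
    { walk      = ~-sym p~u ◅ walk
    ; isPath    = All.map (λ z<u u≡z → ℕ.<⇒≢ z<u (cong dist (sym u≡z))) below-u ∷ isPath
    ; rest      = vertices walk
    ; vertices≡ = refl
    ; below     = below-u
    ; length≡   = trans length-vertices (sym dist-u)
    }
    where
    open Descent D
    p<u : dist p ℕ.< dist u
    p<u = ℕ.≤-reflexive (sym dist-u)
    below-u : All (λ z → dist z ℕ.< dist u) (vertices walk)
    below-u = subst (All _) (sym vertices≡) (p<u ∷ All.map (λ z<p → ℕ.<-trans z<p p<u) below)

  descent : ∀ {l} u → dist u ≡ l → Descent u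
  descent {zero} u dist≡0 with refl ← dist≡0⇒root dist≡0 = record
    { walk = ε ; isPath = [] ∷ [] ; rest = [] ; vertices≡ = refl ; below = [] ; length≡ = sym dist-root }
  descent {suc l} u dist≡ with parent dist≡
  ... | p , p⟶u , dist-p = descend p⟶u (descent p dist-p)

  -- At equal distance, `v` would have two paths to the root: its own descent, and the edge to `u`
  -- followed by the descent of `u`. The second has one vertex more, against uniqueness of paths.
  ~⇒dist≢ : ∀ {u v} → u ~ v → dist u ≢ dist v
  ~⇒dist≢ {u} {v} u~v dist≡ = ℕ.1+n≢n (begin
    suc (dist v)                         ≡⟨ cong suc dist≡ ⟨
    suc (dist u)                         ≡⟨ Descent.length-vertices Dᵤ ⟨
    length (vertices (Descent.walk Dᵤ))  ≡⟨ ℕ.suc-injective (begin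
      suc (length (vertices (Descent.walk Dᵤ)))
        ≡⟨ cong length (proj₂ (isTree v root) (Descent.walk Dᵥ) (~-sym u~v ◅ Descent.walk Dᵤ)
             (Descent.isPath Dᵥ) (v∉ ∷ Descent.isPath Dᵤ)) ⟨
      length (vertices (Descent.walk Dᵥ))
        ≡⟨ Descent.length-vertices Dᵥ ⟩
      suc (dist v)  ∎) ⟩
    dist v                               ∎)
    where
    open ≡-Reasoning
    Dᵤ : Descent u
    Dᵤ = descent u refl
    Dᵥ : Descent v
    Dᵥ = descent v refl
    v∉ : All (v ≢_) (vertices (Descent.walk Dᵤ))
    v∉ = subst (All _) (sym (Descent.vertices≡ Dᵤ))
      ((λ { refl → ~-irrefl u~v }) ∷ All.map (λ { z<u refl → ℕ.<⇒≢ z<u (sym dist≡) }) (Descent.below Dᵤ))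

  -- Each parent extends its descent to a path from `u` to the root. The two paths have the same
  -- vertices, and the parent is the second one.
  ⟶-unique : ∀ {p p′ u} → p ⟶ u → p′ ⟶ u → p ≡ p′
  ⟶-unique {p} {p′} {u} p⟶u p′⟶u = List.∷-injectiveˡ (begin
    p ∷ Descent.rest Dₚ             ≡⟨ Descent.vertices≡ Dₚ ⟨
    vertices (Descent.walk Dₚ)      ≡⟨ List.∷-injectiveʳ (proj₂ (isTree u root)
                                         (Descent.walk (descend p⟶u Dₚ)) (Descent.walk (descend p′⟶u Dₚ′))
                                         (Descent.isPath (descend p⟶u Dₚ))
                                         (Descent.isPath (descend p′⟶u Dₚ′))) ⟩
    vertices (Descent.walk Dₚ′)     ≡⟨ Descent.vertices≡ Dₚ′ ⟩
    p′ ∷ Descent.rest Dₚ′           ∎)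
    where
    open ≡-Reasoning
    Dₚ : Descent p
    Dₚ = descent p refl
    Dₚ′ : Descent p′
    Dₚ′ = descent p′ refl

  neighbour : ∀ {u v} → u ~ v → u ⟶ v ∨ v ⟶ u
  neighbour {u} {v} u~v with ℕ.<-cmp (dist u) (dist v)
  ... | tri< u<v _ _ = inj₁ (ℕ.≤-antisym (~⇒dist≤ u~v) u<v , u~v)
  ... | tri≈ _ u≡v _ = ⊥-elim (~⇒dist≢ u~v u≡v)
  ... | tri> _ _ v<u = inj₂ (ℕ.≤-antisym (~⇒dist≤ (~-sym u~v)) v<u , ~-sym u~v)

  ⟶-asym : ∀ {u v} → u ⟶ v → ¬ (v ⟶ u)
  ⟶-asym (v≡1+u , _) (u≡1+v , _) = ℕ.<-asym (ℕ.≤-reflexive (sym v≡1+u)) (ℕ.≤-reflexive (sym u≡1+v))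

  ¬⟶root : ∀ {p} → ¬ (p ⟶ root)
  ¬⟶root (dist≡ , _) = ℕ.0≢1+n (trans (sym dist-root) dist≡)

  -- Junk value: par root = root.
  par : Fin n → Fin n
  par v with Fin.any? (_⟶? v)
  ... | yes (p , _) = p
  ... | no _        = root

  par-root : par root ≡ root
  par-root with Fin.any? (_⟶? root)
  ... | yes (_ , p⟶root) = ⊥-elim (¬⟶root p⟶root)
  ... | no _             = refl

  ⟶⇒par≡ : ∀ {p c} → p ⟶ c → par c ≡ p
  ⟶⇒par≡ {p} {c} p⟶c with Fin.any? (_⟶? c)
  ... | yes (_ , p′⟶c) = ⟶-unique p′⟶c p⟶c
  ... | no ¬∃          = ⊥-elim (¬∃ (p , p⟶c))

  par⟶ : ∀ {v} → v ≢ root → par v ⟶ v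
  par⟶ {v} v≢root = go (dist v) refl
    where
    go : ∀ l → dist v ≡ l → par v ⟶ v
    go zero    dist≡0 = ⊥-elim (v≢root (dist≡0⇒root dist≡0))
    go (suc l) dist≡ with parent dist≡
    ... | p , p⟶v , _ = subst (_⟶ v) (sym (⟶⇒par≡ p⟶v)) p⟶v

  -- Junk value: heir p = p when p has no child.
  heir : Fin n → Fin n
  heir p with Fin.any? (p ⟶?_)
  ... | yes (c , _) = c
  ... | no _        = p

  ⟶heir : ∀ {p c} → p ⟶ c → p ⟶ heir p
  ⟶heir {p} {c} p⟶c with Fin.any? (p ⟶?_)
  ... | yes (_ , p⟶c′) = p⟶c′
  ... | no ¬∃          = ⊥-elim (¬∃ (c , p⟶c))

  Heir : Fin n → Set
  Heir c = heir (par c) ≡ c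

  heir? : Decidable Heir
  heir? c = heir (par c) Fin.≟ c

  module _ {c ℓ} (S : CommutativeSemiring c ℓ) where
    open CommutativeSemiring S using (_≈_; _+_; +-identityˡ; +-identityʳ; +-cong; +-congʳ)
      renaming (trans to ≈-trans; sym to ≈-sym)
    open FiniteSum S

    -- The semiring is arbitrary because the identity serves twice: in ℕ for degrees, and in the
    -- field for the adjacency matrix.
    ind-neighbour : ∀ u v → ind (u ~? v) ≈ ind (v ⟶? u) + ind (u ⟶? v)
    ind-neighbour u v with v ⟶? u
    ... | yes v⟶u = ≈-trans (ind-true (u ~? v) (~-sym (proj₂ v⟶u)))
          (≈-sym (≈-trans (+-cong (ind-true (v ⟶? u) v⟶u) (ind-false (u ⟶? v) (⟶-asym v⟶u))) (+-identityʳ _)))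
    ... | no ¬v⟶u = ≈-trans (ind-⇔ (u ~? v) (u ⟶? v) only proj₂)
          (≈-sym (≈-trans (+-congʳ (ind-false (v ⟶? u) ¬v⟶u)) (+-identityˡ _)))
      where
      only : u ~ v → u ⟶ v
      only u~v with neighbour u~v
      ... | inj₁ u⟶v = u⟶v
      ... | inj₂ v⟶u = ⊥-elim (¬v⟶u v⟶u)

  open ℕ-Sum
  open Counting

  parentCount childCount : Fin n → ℕ
  parentCount u = sum λ v → ind (v ⟶? u)
  childCount u  = sum λ v → ind (u ⟶? v)

  degree≡ : ∀ u → degree u ≡ parentCount u ℕ.+ childCount u
  degree≡ u = trans (count≡sum (u ~?_)) (trans (sum-cong-≋ (ind-neighbour ℕ.+-*-commutativeSemiring u))
    (∑-distrib-+ (λ v → ind (v ⟶? u)) (λ v → ind (u ⟶? v))))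

  parentCount-root : parentCount root ≡ 0
  parentCount-root = sum-ind-zero (_⟶? root) λ _ → ¬⟶root

  parentCount-nonroot : ∀ {v} → v ≢ root → parentCount v ≡ 1
  parentCount-nonroot {v} v≢root =
    sum-ind-one (_⟶? v) (par⟶ v≢root) λ _ p⟶v → ⟶-unique p⟶v (par⟶ v≢root)

-- Levels and cardinalities in a generalized Bethe tree.

module BetheTree {k} (2≤k : 2 ℕ.≤ k) (B : GeneralizedBetheTree k) where
  open GeneralizedBetheTree B
  open ≡ using (refl; sym; trans; cong; subst)
  open RootedTree graph isTree root dist isDistance public
  open ℕ-Sum
  open Counting

  dist≡k∸index : ∀ v → dist v ≡ k ∸ index v
  dist≡k∸index v = sym (ℕ.m∸[m∸n]≡n (ℕ.<⇒≤ (level≤k v)))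

  index-injective-dist : ∀ {u v} → index u ≡ index v → dist u ≡ dist v
  index-injective-dist {u} {v} eq =
    trans (dist≡k∸index u) (trans (cong (k ∸_) eq) (sym (dist≡k∸index v)))

  index-⟶ : ∀ {p c} → p ⟶ c → index p ≡ suc (index c)
  index-⟶ {p} {c} (dist≡ , _) =
    trans (ℕ.+-∸-assoc 1 (subst (ℕ._≤ k) dist≡ (ℕ.<⇒≤ (level≤k c)))) (cong (λ l → suc (k ∸ l)) (sym dist≡))

  0<index : ∀ v → 0 ℕ.< index v
  0<index v = ℕ.m<n⇒0<n∸m (level≤k v)

  index≤k : ∀ v → index v ℕ.≤ k
  index≤k v = ℕ.m∸n≤m k (dist v)

  index-root : index root ≡ k
  index-root = cong (k ∸_) dist-root

  index≡k⇒root : ∀ {v} → index v ≡ k → v ≡ root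
  index≡k⇒root {v} eq = dist≡0⇒root (trans (dist≡k∸index v) (trans (cong (k ∸_) eq) (ℕ.n∸n≡0 k)))

  index<k⇒≢root : ∀ {v} → index v ℕ.< k → v ≢ root
  index<k⇒≢root index<k refl = ℕ.<⇒≢ index<k index-root

  -- The ancestors of a deepest vertex pass through every level.
  index-surjective : ∀ i → i ℕ.< k → ∃ λ v → index v ≡ suc i
  index-surjective zero _ with deepest
  ... | v , level≡k = v , trans (cong (suc k ∸_) level≡k) (ℕ.m+n∸n≡m 1 k)
  index-surjective (suc i) i<k with index-surjective i (ℕ.<⇒≤ i<k)
  ... | v , index≡ = par v ,
    trans (index-⟶ (par⟶ (index<k⇒≢root (subst (ℕ._< k) (sym index≡) i<k)))) (cong suc index≡)

  parentCount-dist : ∀ {u v} → dist u ≡ dist v → parentCount u ≡ parentCount v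
  parentCount-dist {u} {v} dist≡ with u Fin.≟ root | v Fin.≟ root
  ... | yes refl | yes refl = refl
  ... | yes refl | no v≢    = ⊥-elim (v≢ (dist≡0⇒root (trans (sym dist≡) dist-root)))
  ... | no u≢    | yes refl = ⊥-elim (u≢ (dist≡0⇒root (trans dist≡ dist-root)))
  ... | no u≢    | no v≢    = trans (parentCount-nonroot u≢) (sym (parentCount-nonroot v≢))

  childCount-index : ∀ {u v} → index u ≡ index v → childCount u ≡ childCount v
  childCount-index {u} {v} eq = ℕ.+-cancelˡ-≡ (parentCount u) _ _ (begin
    parentCount u ℕ.+ childCount u  ≡⟨ degree≡ u ⟨
    degree u                        ≡⟨ degree≡d u ⟩
    d (index u)                     ≡⟨ cong d eq ⟩
    d (index v)                     ≡⟨ degree≡d v ⟨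
    degree v                        ≡⟨ degree≡ v ⟩
    parentCount v ℕ.+ childCount v  ≡⟨ cong (ℕ._+ childCount v) (parentCount-dist (index-injective-dist eq)) ⟨
    parentCount u ℕ.+ childCount v  ∎)
    where open ≡-Reasoning

  index≡1⇒leaf : ∀ {u v} → index u ≡ 1 → ¬ (u ⟶ v)
  index≡1⇒leaf {u} {v} index≡1 u⟶v =
    ℕ.<⇒≢ (0<index v) (ℕ.suc-injective (trans (sym index≡1) (index-⟶ u⟶v)))

  -- Some vertex of the same index is a parent, and the number of children depends on the index
  -- only. So childless vertices occur on the deepest level alone.
  has-child : ∀ {u i} → index u ≡ suc (suc i) → ∃ (u ⟶_)
  has-child {u} {i} index-u = 1≤sum-ind⇒∃ (u ⟶?_) (subst (1 ℕ.≤_) (childCount-index same-index)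
    (1≤sum-ind (p ⟶?_) p⟶c))
    where
    i<k : suc i ℕ.< k
    i<k = subst (ℕ._≤ k) index-u (index≤k u)
    c p : Fin order
    c = proj₁ (index-surjective i (ℕ.<⇒≤ i<k))
    p = par c
    index-c : index c ≡ suc i
    index-c = proj₂ (index-surjective i (ℕ.<⇒≤ i<k))
    p⟶c : p ⟶ c
    p⟶c = par⟶ (index<k⇒≢root (subst (ℕ._< k) (sym index-c) i<k))
    same-index : index p ≡ index u
    same-index = trans (index-⟶ p⟶c) (trans (cong suc index-c) (sym index-u))

  index-child : ∀ {u c i} → index u ≡ suc (suc i) → u ⟶ c → index c ≡ suc i
  index-child index-u u⟶c = ℕ.suc-injective (trans (sym (index-⟶ u⟶c)) index-u)

  index-predecessor : ∀ u → index u ≡ suc (ℕ.pred (index u))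
  index-predecessor u = sym (ℕ.suc-pred (index u) {{ℕ.>-nonZero (0<index u)}})

  -- The case distinction mirrors `offDiagonal`, so that every off-diagonal entry is `β` times the
  -- square root of `children s`.
  children : ℕ → ℕ
  children s = if does (s ℕ.≟ k) then d s else d s ∸ 1

  children-k : ∀ {s} → s ≡ k → children s ≡ d s
  children-k {s} s≡k rewrite dec-true (s ℕ.≟ k) s≡k = refl

  children-≢k : ∀ {s} → s ≢ k → children s ≡ d s ∸ 1
  children-≢k {s} s≢k rewrite dec-false (s ℕ.≟ k) s≢k = refl

  degree≡1+childCount : ∀ {u} → u ≢ root → d (index u) ≡ suc (childCount u)
  degree≡1+childCount {u} u≢root = begin
    d (index u)                     ≡⟨ degree≡d u ⟨
    degree u                        ≡⟨ degree≡ u ⟩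
    parentCount u ℕ.+ childCount u  ≡⟨ cong (ℕ._+ childCount u) (parentCount-nonroot u≢root) ⟩
    suc (childCount u)              ∎
    where open ≡-Reasoning

  childCount≡children : ∀ u → childCount u ≡ children (index u)
  childCount≡children u with u Fin.≟ root
  ... | yes refl  = begin
    childCount root                       ≡⟨ cong (ℕ._+ childCount root) parentCount-root ⟨
    parentCount root ℕ.+ childCount root  ≡⟨ degree≡ root ⟨
    degree root                           ≡⟨ degree≡d root ⟩
    d (index root)                        ≡⟨ children-k index-root ⟨
    children (index root)                 ∎
    where open ≡-Reasoning
  ... | no u≢root = sym (trans (children-≢k (u≢root ∘ index≡k⇒root)) (cong (_∸ 1) (degree≡1+childCount u≢root)))

  1≤childCount : ∀ {u i} → index u ≡ suc (suc i) → 1 ℕ.≤ childCount u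
  1≤childCount {u} index-u = 1≤sum-ind (u ⟶?_) (proj₂ (has-child index-u))

  1≤children : ∀ i → 1 ℕ.≤ i → i ℕ.< k → 1 ℕ.≤ children (suc i)
  1≤children (suc i) _ i<k with index-surjective (suc i) i<k
  ... | u , index-u = subst (1 ℕ.≤_)
    (trans (childCount≡children u) (cong children index-u)) (1≤childCount index-u)

  -- As `k ≥ 2`, a deepest vertex has a parent and no child. This makes the exceptional first
  -- diagonal entry `α` an instance of `α * d s`.
  d1≡1 : d 1 ≡ 1
  d1≡1 with index-surjective 0 (ℕ.<⇒≤ 2≤k)
  ... | v , index-v = trans (cong d (sym index-v)) (trans
    (degree≡1+childCount (index<k⇒≢root (subst (ℕ._< k) (sym index-v) 2≤k)))
    (cong suc (sum-ind-zero (v ⟶?_) λ _ → index≡1⇒leaf index-v)))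

  -- The default `par root = root` turns the claim into `heir root ≢ root`. The root has a child
  -- because `k ≥ 2`, so `heir root` is a child of the root, which the root itself is not.
  ¬Heir-root : ¬ Heir root
  ¬Heir-root heir-root = ¬⟶root (subst (root ⟶_) (trans (cong heir (sym par-root)) heir-root)
    (⟶heir (proj₂ (has-child {i = k ∸ 2} (trans index-root (sym (ℕ.m+[n∸m]≡n 2≤k)))))))

  nonHeirs : ℕ → ℕ
  nonHeirs i = sum λ v → ind ((index v ℕ.≟ i) ×-dec ¬? (heir? v))

  -- `heir` and `par` are inverse bijections between the vertices of index `suc i` and the heirs of
  -- index `i`, since every vertex of index `suc i` has a child.
  n≡n+nonHeirs : ∀ i → 1 ℕ.≤ i → i ℕ.< k → n i ≡ n (suc i) ℕ.+ nonHeirs i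
  n≡n+nonHeirs i@(suc _) _ i<k = begin
    n i
      ≡⟨ count≡sum (λ v → index v ℕ.≟ i) ⟩
    sum (λ v → ind (index v ℕ.≟ i))
      ≡⟨ sum-cong-≋ (λ v → ind-split (index v ℕ.≟ i) (heir? v)) ⟩
    sum (λ v → ind ((index v ℕ.≟ i) ×-dec heir? v) ℕ.+ ind ((index v ℕ.≟ i) ×-dec ¬? (heir? v)))
      ≡⟨ ∑-distrib-+ (λ v → ind ((index v ℕ.≟ i) ×-dec heir? v)) _ ⟩
    sum (λ v → ind ((index v ℕ.≟ i) ×-dec heir? v)) ℕ.+ nonHeirs i
      ≡⟨ cong (ℕ._+ nonHeirs i) (sum-bijection (λ v → index v ℕ.≟ suc i)
           (λ v → (index v ℕ.≟ i) ×-dec heir? v) heir par to from) ⟨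
    sum (λ v → ind (index v ℕ.≟ suc i)) ℕ.+ nonHeirs i
      ≡⟨ cong (ℕ._+ nonHeirs i) (count≡sum (λ v → index v ℕ.≟ suc i)) ⟨
    n (suc i) ℕ.+ nonHeirs i ∎
    where
    open ≡-Reasoning
    to : ∀ {p} → index p ≡ suc i → (index (heir p) ≡ i × Heir (heir p)) × par (heir p) ≡ p
    to {p} index-p =
      (ℕ.suc-injective (trans (sym (index-⟶ p⟶heir)) index-p) , cong heir (⟶⇒par≡ p⟶heir)) ,
      ⟶⇒par≡ p⟶heir
      where
      p⟶heir : p ⟶ heir p
      p⟶heir = ⟶heir (proj₂ (has-child index-p))
    from : ∀ {c} → index c ≡ i × Heir c → index (par c) ≡ suc i × heir (par c) ≡ c
    from (index-c , heir-c) =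
      trans (index-⟶ (par⟶ (index<k⇒≢root (subst (ℕ._< k) (sym index-c) i<k)))) (cong suc index-c) , heir-c

  n∸n≡nonHeirs : ∀ i → 1 ℕ.≤ i → i ℕ.< k → n i ∸ n (suc i) ≡ nonHeirs i
  n∸n≡nonHeirs i 1≤i i<k = trans (cong (_∸ n (suc i)) (n≡n+nonHeirs i 1≤i i<k)) (ℕ.m+n∸m≡n (n (suc i)) _)

  -- Gives T_k its multiplicity 1 by the same count that weights the smaller matrices.
  nonHeirs-k : nonHeirs k ≡ 1
  nonHeirs-k = sum-ind-one (λ v → (index v ℕ.≟ k) ×-dec ¬? (heir? v)) (index-root , ¬Heir-root)
    λ _ (index≡k , _) → index≡k⇒root index≡k

-- Enumerating decidable subsets.

module Enumerations {c ℓ} (S : CommutativeSemiring c ℓ) where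
  open CommutativeSemiring S hiding (zero)
  open FiniteSum S

  record Enumeration {n p} {P : Pred (Fin n) p} (P? : Decidable P) : Set (c Level.⊔ ℓ Level.⊔ p) where
    field
      size      : ℕ
      at        : Fin size → Fin n
      at∈       : ∀ j → P (at j)
      injective : ∀ {i j} → at i ≡ at j → i ≡ j
      sum-at    : ∀ g → sum (g ∘ at) ≈ sum (λ v → ind (P? v) * g v)
      size≡     : size ≡ ℕ-Sum.sum (ℕ-Sum.ind ∘ P?)

  enumerate : ∀ {n p} {P : Pred (Fin n) p} (P? : Decidable P) → Enumeration P?
  enumerate {zero} P? = record
    { size = 0 ; at = λ () ; at∈ = λ () ; injective = λ {} ; sum-at = λ _ → refl ; size≡ = ≡.refl }
  enumerate {suc n} {P = P} P? with P? zero | enumerate (P? ∘ suc)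
  ... | no ¬p₀ | E = record
    { size      = size
    ; at        = suc ∘ at
    ; at∈       = at∈
    ; injective = injective ∘ Fin.suc-injective
    ; sum-at    = λ g → trans (sum-at (g ∘ suc))
        (sym (trans (+-congʳ (trans (*-congʳ (ind-false (P? zero) ¬p₀)) (zeroˡ (g zero)))) (+-identityˡ _)))
    ; size≡     = ≡.cong₂ ℕ._+_ (≡.sym (ℕ-Sum.ind-false (P? zero) ¬p₀)) size≡
    }
    where open Enumeration E
  ... | yes p₀ | E = record
    { size      = suc size
    ; at        = at⁺
    ; at∈       = at∈⁺
    ; injective = injective⁺
    ; sum-at    = λ g → +-cong
        (sym (trans (*-congʳ (ind-true (P? zero) p₀)) (*-identityˡ (g zero)))) (sum-at (g ∘ suc))
    ; size≡     = ≡.cong₂ ℕ._+_ (≡.sym (ℕ-Sum.ind-true (P? zero) p₀)) size≡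
    }
    where
    open Enumeration E
    at⁺ : Fin (suc size) → Fin (suc n)
    at⁺ zero    = zero
    at⁺ (suc j) = suc (at j)
    at∈⁺ : ∀ j → P (at⁺ j)
    at∈⁺ zero    = p₀
    at∈⁺ (suc j) = at∈ j
    injective⁺ : ∀ {i j} → at⁺ i ≡ at⁺ j → i ≡ j
    injective⁺ {zero}  {zero}  _  = ≡.refl
    injective⁺ {suc i} {suc j} eq = ≡.cong suc (injective (Fin.suc-injective eq))

-- A basis of each eigenspace of the tree.

module TreeEigenspace {ℓ} (R : Reals ℓ) {k} (2≤k : 2 ℕ.≤ k) (B : GeneralizedBetheTree k)
  (α : Reals.Carrier R) (α<1 : Reals._<_ R α (Reals.1# R)) where
  open Reals R hiding (zero)
  open Spectral R hiding (β; _⊎_)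
  open OrderedField R
  open FiniteSum commutativeSemiring
  open GeneralizedBetheTree B hiding (n)
  open BetheTree 2≤k B
  open import Relation.Binary.Reasoning.Setoid setoid

  β : Carrier
  β = 1# - α

  0<β : 0# < β
  0<β = <⇒0<- α<1

  D μ : ℕ → Carrier
  D s = diagonal B α s
  μ s = fromℕ (children s)

  open ThreeTerm R β 0<β D μ

  if≈ind : ∀ {p} {P : Set p} (P? : Dec P) x → (if does P? then x else 0#) ≈ ind P? * x
  if≈ind (yes _) x = sym (*-identityˡ x)
  if≈ind (no _)  x = sym (zeroˡ x)

  fromℕ-sum : ∀ {m} (g : Fin m → ℕ) → fromℕ (ℕ-Sum.sum g) ≈ sum (fromℕ ∘ g)
  fromℕ-sum {zero}  g = refl
  fromℕ-sum {suc m} g = trans (Mult.×-homo-+ semiring 1# (g zero) (ℕ-Sum.sum (g ∘ suc)))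
    (+-congˡ (fromℕ-sum (g ∘ suc)))

  fromℕ-ind : ∀ {p} {P : Set p} (P? : Dec P) → fromℕ (ℕ-Sum.ind P?) ≈ ind P?
  fromℕ-ind (yes _) = +-identityʳ 1#
  fromℕ-ind (no _)  = refl

  diagonal≈ : ∀ s → D s ≈ α * fromℕ (d s)
  diagonal≈ s = go (s ℕ.≟ 1)
    where
    go : (s≟1 : Dec (s ≡ 1)) → (if does s≟1 then α else α * fromℕ (d s)) ≈ α * fromℕ (d s)
    go (yes ≡.refl) = sym (trans
      (*-congˡ (trans (reflexive (≡.cong fromℕ d1≡1)) (+-identityʳ 1#))) (*-identityʳ α))
    go (no _)       = refl

  up down : (Fin order → Carrier) → Fin order → Carrier
  up   g u = sum λ w → ind (w ⟶? u) * g w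
  down g u = sum λ w → ind (u ⟶? w) * g w

  A-*ᵥ : ∀ v u → (A[_] graph α *ᵥ v) u ≈ D (index u) * v u + β * (up v u + down v u)
  A-*ᵥ v u = begin
    sum (λ w → A[_] graph α u w * v w)
      ≈⟨ sum-cong-≋ term ⟩
    sum (λ w → ind (u Fin.≟ w) * (α * δ * v w) + β * (ind (w ⟶? u) * v w + ind (u ⟶? w) * v w))
      ≈⟨ ∑-distrib-+ (λ w → ind (u Fin.≟ w) * (α * δ * v w)) _ ⟩
    sum (λ w → ind (u Fin.≟ w) * (α * δ * v w)) + sum (λ w → β * (ind (w ⟶? u) * v w + ind (u ⟶? w) * v w))
      ≈⟨ +-cong (sum-only (u Fin.≟_) (λ w → α * δ * v w) ≡.refl λ _ → ≡.sym)
           (trans (sum-*ˡ β λ w → ind (w ⟶? u) * v w + ind (u ⟶? w) * v w)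
             (*-congˡ (∑-distrib-+ (λ w → ind (w ⟶? u) * v w) λ w → ind (u ⟶? w) * v w))) ⟩
    α * δ * v u + β * (up v u + down v u)
      ≈⟨ +-congʳ (*-congʳ (trans (*-congˡ (reflexive (≡.cong fromℕ (degree≡d u))))
                               (sym (diagonal≈ (index u))))) ⟩
    D (index u) * v u + β * (up v u + down v u) ∎
    where
    δ : Carrier
    δ = fromℕ (degree u)
    term : ∀ w → A[_] graph α u w * v w
                 ≈ ind (u Fin.≟ w) * (α * δ * v w) + β * (ind (w ⟶? u) * v w + ind (u ⟶? w) * v w)
    term w = trans
      (*-congʳ (+-cong (*-congˡ (if≈ind (u Fin.≟ w) δ)) (*-congˡ (ind-neighbour commutativeSemiring u w))))
      (trans (distribʳ (v w) _ _) (+-cong (rotate α (ind (u Fin.≟ w)) δ (v w))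
        (spread β (ind (w ⟶? u)) (ind (u ⟶? w)) (v w))))
      where
      rotate : ∀ α i δ v → α * (i * δ) * v ≈ i * (α * δ * v)
      rotate = solve 4 (λ α i δ v → α :* (i :* δ) :* v := i :* (α :* δ :* v)) refl
      spread : ∀ β i j v → β * (i + j) * v ≈ β * (i * v + j * v)
      spread = solve 4 (λ β i j v → β :* (i :+ j) :* v := β :* (i :* v :+ j :* v)) refl

  up-child : ∀ g {p c} → p ⟶ c → up g c ≈ g p
  up-child g {p} {c} p⟶c = sum-only (_⟶? c) g p⟶c λ _ p′⟶c → ⟶-unique p′⟶c p⟶c

  up-root : ∀ g → up g root ≈ 0#
  up-root g = sum-none (_⟶? root) g λ _ → ¬⟶root

  down-cong : ∀ {g h} u → (∀ {c} → u ⟶ c → g c ≈ h c) → down g u ≈ down h u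
  down-cong u g≈h = sum-cong-≋ λ c → ind-cong (u ⟶? c) g≈h

  up-cong : ∀ {g h} u → (∀ {p} → p ⟶ u → g p ≈ h p) → up g u ≈ up h u
  up-cong u g≈h = sum-cong-≋ λ p → ind-cong (p ⟶? u) g≈h

  #children : Fin order → Carrier
  #children u = fromℕ (childCount u)

  #children≈μ : ∀ u → #children u ≈ μ (index u)
  #children≈μ u = reflexive (≡.cong fromℕ (childCount≡children u))

  #children≉0 : ∀ {u i} → index u ≡ suc (suc i) → ¬ (#children u ≈ 0#)
  #children≉0 index-u = 0<⇒≉0 (0<fromℕ (1≤childCount index-u))

  down-const : ∀ u c → down (λ _ → c) u ≈ #children u * c
  down-const u c = trans (sum-*ʳ (λ w → ind (u ⟶? w)) c) (*-congʳ (sym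
    (trans (fromℕ-sum λ w → ℕ-Sum.ind (u ⟶? w)) (sum-cong-≋ λ w → fromℕ-ind (u ⟶? w)))))

  down-up : ∀ g u → down (up g) u ≈ #children u * g u
  down-up g u = trans (down-cong u (up-child g)) (down-const u (g u))

  weighted-*ʳ : ∀ {m} (a g : Fin m → Carrier) y → sum (λ w → a w * (g w * y)) ≈ sum (λ w → a w * g w) * y
  weighted-*ʳ a g y = trans (sum-cong-≋ λ w → sym (*-assoc (a w) (g w) y)) (sum-*ʳ (λ w → a w * g w) y)

  -- The mean value property over children. Without division it also holds at childless vertices,
  -- where both sides are zero.
  Coherent : (Fin order → Carrier) → Set ℓ
  Coherent t = ∀ u → down t u ≈ #children u * t u

  module _ (x : Carrier) where
    F : ℕ → Carrier
    F = f x

    recurrence-at : ∀ {i} → 0 ℕ.< i → D i * F i + β * (F (suc i) + μ i * F (ℕ.pred i)) ≈ x * F i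
    recurrence-at {suc s} _ = recurrence x s

    -- In an eigenvector, the average of the values at the leaves below u is a t u
    -- with v u = t u F (index u).
    record Represents (v t : Fin order → Carrier) : Set ℓ where
      field
        v≈tF     : ∀ u → v u ≈ t u * F (index u)
        gap      : ∀ u → up t u * F (suc (index u)) ≈ t u * F (suc (index u))
        coherent : Coherent t

    up-tF : ∀ {v t} → (∀ u → v u ≈ t u * F (index u)) → ∀ u → up v u ≈ up t u * F (suc (index u))
    up-tF {v} {t} v≈tF u = trans
      (up-cong u λ {p} p⟶u → trans (v≈tF p) (*-congˡ (reflexive (≡.cong F (index-⟶ p⟶u)))))
      (weighted-*ʳ (λ w → ind (w ⟶? u)) t _)

    down-tF : ∀ {v t} → Coherent t → ∀ u → (∀ {c} → u ⟶ c → v c ≈ t c * F (index c)) →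
              down v u ≈ t u * (μ (index u) * F (ℕ.pred (index u)))
    down-tF {v} {t} coherent u v≈tF = begin
      down v u
        ≈⟨ down-cong u (λ {c} u⟶c → trans (v≈tF u⟶c) (*-congˡ (reflexive
             (≡.cong (F ∘ ℕ.pred) (≡.sym (index-⟶ u⟶c)))))) ⟩
      down (λ c → t c * F (ℕ.pred (index u))) u
        ≈⟨ weighted-*ʳ (λ w → ind (u ⟶? w)) t _ ⟩
      down t u * F (ℕ.pred (index u))
        ≈⟨ *-congʳ (trans (coherent u) (*-congʳ (#children≈μ u))) ⟩
      μ (index u) * t u * F (ℕ.pred (index u))
        ≈⟨ solve 3 (λ m t f → m :* t :* f := t :* (m :* f)) refl (μ (index u)) (t u) _ ⟩
      t u * (μ (index u) * F (ℕ.pred (index u))) ∎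

    scaled-recurrence : ∀ t {i} → 0 ℕ.< i →
      D i * (t * F i) + β * (t * F (suc i) + t * (μ i * F (ℕ.pred i))) ≈ x * (t * F i)
    scaled-recurrence t {i} 0<i = begin
      D i * (t * F i) + β * (t * F (suc i) + t * (μ i * F (ℕ.pred i)))
        ≈⟨ pull t (D i) (F i) β (F (suc i)) (μ i * F (ℕ.pred i)) ⟩
      t * (D i * F i + β * (F (suc i) + μ i * F (ℕ.pred i)))
        ≈⟨ *-congˡ (recurrence-at 0<i) ⟩
      t * (x * F i)
        ≈⟨ solve 3 (λ t x f → t :* (x :* f) := x :* (t :* f)) refl t x (F i) ⟩
      x * (t * F i) ∎
      where
      pull : ∀ t d f₁ β f₂ y → d * (t * f₁) + β * (t * f₂ + t * y) ≈ t * (d * f₁ + β * (f₂ + y))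
      pull = solve 6 (λ t d f₁ β f₂ y → d :* (t :* f₁) :+ β :* (t :* f₂ :+ t :* y)
                        := t :* (d :* f₁ :+ β :* (f₂ :+ y))) refl

    -- `gap` replaces the parent's factor by `t u`, and coherence turns the sum over the children
    -- into `t u` times the lower term, so the equation at `u` is `t u` times the recurrence. At the
    -- root `up` is zero, and `gap` states that the upper term vanishes.
    represents⇒eigen : ∀ {v t} → Represents v t → Eigenspace (A[_] graph α) x v
    represents⇒eigen {v} {t} rep u = begin
      (A[_] graph α *ᵥ v) u
        ≈⟨ A-*ᵥ v u ⟩
      D (index u) * v u + β * (up v u + down v u)
        ≈⟨ +-cong (*-congˡ (v≈tF u)) (*-congˡ (+-cong
             (trans (up-tF v≈tF u) (gap u)) (down-tF coherent u λ {c} _ → v≈tF c))) ⟩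
      D (index u) * (t u * F (index u))
        + β * (t u * F (suc (index u)) + t u * (μ (index u) * F (ℕ.pred (index u))))
        ≈⟨ scaled-recurrence (t u) (0<index u) ⟩
      x * (t u * F (index u))
        ≈⟨ *-congˡ (v≈tF u) ⟨
      x * v u ∎
      where open Represents rep

    module _ {v} (v-eigen : Eigenspace (A[_] graph α) x v) where
      -- The first argument counts the levels to descend. `t` descends exactly to the deepest level,
      -- so no division by a zero number of children takes place in it.
      average : ℕ → Fin order → Carrier
      average zero    u = v u
      average (suc i) u = inv (#children u) * down (average i) u

      t : Fin order → Carrier
      t u = average (ℕ.pred (index u)) u

      t≈average : ∀ {i u} → index u ≡ suc i → t u ≈ average i u
      t≈average {u = u} index-u = reflexive (≡.cong (λ i → average (ℕ.pred i) u) index-u)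

      t-coherent : Coherent t
      t-coherent u = go (index u) ≡.refl
        where
        go : ∀ i → index u ≡ i → down t u ≈ #children u * t u
        go zero          index-u = ⊥-elim (ℕ.<⇒≢ (0<index u) (≡.sym index-u))
        go (suc zero)    index-u = trans (sum-none (u ⟶?_) t λ _ → index≡1⇒leaf index-u)
          (sym (*≈0ˡ _ (reflexive (≡.cong fromℕ (Counting.sum-ind-zero (u ⟶?_) λ _ → index≡1⇒leaf index-u)))))
        go (suc (suc i)) index-u = trans
          (down-cong u λ u⟶c → t≈average (index-child index-u u⟶c))
          (sym (trans (*-congˡ (t≈average index-u)) (x*[inv-x*y]≈y _ (#children≉0 index-u))))

      -- The eigenvalue equation at `u` and `t u` times the recurrence agree in all terms but the
      -- parent's, and `β` is nonzero.
      up≈tF : ∀ u → v u ≈ t u * F (index u) → down v u ≈ t u * (μ (index u) * F (ℕ.pred (index u))) →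
              up v u ≈ t u * F (suc (index u))
      up≈tF u v≈ down≈ = +-cancelʳ (down v u) _ _ (*-cancelˡ β≉0 (+-cancelˡ (D (index u) * v u) _ _ (begin
        D (index u) * v u + β * (up v u + down v u)
          ≈⟨ A-*ᵥ v u ⟨
        (A[_] graph α *ᵥ v) u
          ≈⟨ trans (v-eigen u) (*-congˡ v≈) ⟩
        x * (t u * F (index u))
          ≈⟨ scaled-recurrence (t u) (0<index u) ⟨
        D (index u) * (t u * F (index u))
          + β * (t u * F (suc (index u)) + t u * (μ (index u) * F (ℕ.pred (index u))))
          ≈⟨ +-cong (*-congˡ v≈) (*-congˡ (+-congˡ down≈)) ⟨
        D (index u) * v u + β * (t u * F (suc (index u)) + down v u) ∎)))

      -- Induction from the deepest level, where `t` is `v` and `F 1 = 1`. Each child `c` of `u`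
      -- expresses the parent's value as `t c * F (index u)` through its own equation; summing over
      -- the children and applying coherence replaces `t c` by `t u`.
      v≈tF-at : ∀ i u → index u ≡ suc i → v u ≈ t u * F (index u)
      up≈tF-at : ∀ i u → index u ≡ suc i → up v u ≈ t u * F (suc (index u))

      v≈tF-at zero u index-u = sym (trans
        (*-cong (t≈average index-u) (reflexive (≡.cong F index-u)))
        (*-identityʳ (v u)))
      v≈tF-at (suc i) u index-u = *-cancelˡ (#children≉0 index-u) (begin
        #children u * v u
          ≈⟨ down-up v u ⟨
        down (up v) u
          ≈⟨ down-cong u (λ {c} u⟶c → trans
               (up≈tF-at i c (index-child index-u u⟶c))
               (*-congˡ (reflexive (≡.cong F (≡.sym (index-⟶ u⟶c)))))) ⟩
        down (λ c → t c * F (index u)) u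
          ≈⟨ weighted-*ʳ (λ w → ind (u ⟶? w)) t _ ⟩
        down t u * F (index u)
          ≈⟨ *-congʳ (t-coherent u) ⟩
        #children u * t u * F (index u)
          ≈⟨ *-assoc _ _ _ ⟩
        #children u * (t u * F (index u)) ∎)

      up≈tF-at zero u index-u = up≈tF u (v≈tF-at zero u index-u)
        (down-tF t-coherent u λ u⟶c → ⊥-elim (index≡1⇒leaf index-u u⟶c))
      up≈tF-at (suc i) u index-u = up≈tF u (v≈tF-at (suc i) u index-u)
        (down-tF t-coherent u λ {c} u⟶c → v≈tF-at i c (index-child index-u u⟶c))

      eigen⇒represents : Represents v t
      eigen⇒represents = record
        { v≈tF     = v≈tF
        ; gap      = λ u → trans (sym (up-tF v≈tF u)) (up≈tF-at _ u (index-predecessor u))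
        ; coherent = t-coherent
        }
        where
        v≈tF : ∀ u → v u ≈ t u * F (index u)
        v≈tF u = v≈tF-at _ u (index-predecessor u)

    -- `F` may vanish on higher levels, but `F 1 = 1` gives `t = 0` on the deepest one, and
    -- averaging carries this up.
    coherent-zero : ∀ {t} → Coherent t → (∀ u → t u * F (index u) ≈ 0#) → ∀ u → t u ≈ 0#
    coherent-zero {t} coherent tF≈0 u = go _ u (index-predecessor u)
      where
      go : ∀ i u → index u ≡ suc i → t u ≈ 0#
      go zero    u index-u = trans
        (sym (trans (*-congˡ (reflexive (≡.cong F index-u))) (*-identityʳ _))) (tF≈0 u)
      go (suc i) u index-u = *≈0⇒≈0 (#children≉0 index-u) (trans (sym (coherent u))
        (trans (down-cong u λ {c} u⟶c → go i c (index-child index-u u⟶c)) (trans (down-const u 0#) (zeroʳ _))))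

  -- With first argument `dist u` this sums `δ` along the path from `u` to the root. The counter
  -- stops the recursion at the root, where `par` would stay.
  liftAt : ℕ → (Fin order → Carrier) → Fin order → Carrier
  liftAt zero    δ u = δ u
  liftAt (suc l) δ u = δ u + liftAt l δ (par u)

  lift : (Fin order → Carrier) → Fin order → Carrier
  lift δ u = liftAt (dist u) δ u

  lift-up : ∀ δ u → lift δ u ≈ δ u + up (lift δ) u
  lift-up δ u with u Fin.≟ root
  ... | yes ≡.refl = trans (reflexive (≡.cong (λ l → liftAt l δ root) dist-root))
                           (sym (trans (+-congˡ (up-root (lift δ))) (+-identityʳ _)))
  ... | no u≢root  = trans (reflexive (≡.cong (λ l → liftAt l δ u) (proj₁ (par⟶ u≢root))))
                           (+-congˡ (sym (up-child (lift δ) (par⟶ u≢root))))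

  -- The hypothesis is equality of the increments `t - up t` and `t′ - up t′`, freed of subtraction.
  -- Equality spreads downwards from the root, where `up` is zero.
  lift-unique : ∀ {t t′} → (∀ u → t u + up t′ u ≈ t′ u + up t u) → ∀ u → t u ≈ t′ u
  lift-unique {t} {t′} eq u = go (dist u) u ≡.refl
    where
    go : ∀ l u → dist u ≡ l → t u ≈ t′ u
    go zero u dist≡0 with ≡.refl ← dist≡0⇒root dist≡0 =
      trans (sym (+-identityʳ _)) (trans (+-congˡ (sym (up-root t′))) (trans (eq root)
        (trans (+-congˡ (up-root t)) (+-identityʳ _))))
    go (suc l) u dist≡ = +-cancelʳ (up t u) _ _ (trans
      (+-congˡ (up-cong u λ {p} p⟶u → go l p (dist-parent p⟶u))) (eq u))
      where
      dist-parent : ∀ {p} → p ⟶ u → dist p ≡ l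
      dist-parent (dist-u , _) = ℕ.suc-injective (≡.trans (≡.sym dist-u) dist≡)

  SumsToZero : (Fin order → Carrier) → Set ℓ
  SumsToZero δ = ∀ u → down δ u ≈ 0#

  down-+ : ∀ g h u → down (λ w → g w + h w) u ≈ down g u + down h u
  down-+ g h u = trans (sum-cong-≋ λ w → distribˡ (ind (u ⟶? w)) (g w) (h w))
    (∑-distrib-+ (λ w → ind (u ⟶? w) * g w) λ w → ind (u ⟶? w) * h w)

  -- Each child of `u` has `up t` equal to `t u`, so `down t u` differs from `#children u * t u` by
  -- exactly `down δ u`.
  sumsToZero⇒coherent : ∀ {δ t} → (∀ u → t u ≈ δ u + up t u) → SumsToZero δ → Coherent t
  sumsToZero⇒coherent {δ} {t} t≈ δ≈0 u = begin
    down t u                     ≈⟨ down-cong u (λ {c} _ → t≈ c) ⟩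
    down (λ w → δ w + up t w) u  ≈⟨ down-+ δ (up t) u ⟩
    down δ u + down (up t) u     ≈⟨ +-cong (δ≈0 u) (down-up t u) ⟩
    0# + #children u * t u       ≈⟨ +-identityˡ _ ⟩
    #children u * t u            ∎

  coherent⇒sumsToZero : ∀ {δ t} → (∀ u → t u ≈ δ u + up t u) → Coherent t → SumsToZero δ
  coherent⇒sumsToZero {δ} {t} t≈ coherent u = +-cancelʳ (#children u * t u) _ _ (begin
    down δ u + #children u * t u  ≈⟨ +-congˡ (down-up t u) ⟨
    down δ u + down (up t) u      ≈⟨ down-+ δ (up t) u ⟨
    down (λ w → δ w + up t w) u   ≈⟨ down-cong u (λ {c} _ → t≈ c) ⟨
    down t u                      ≈⟨ coherent u ⟩
    #children u * t u             ≈⟨ +-identityˡ _ ⟨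
    0# + #children u * t u        ∎)

  -- The increments of the vector which is 1 at and below c and -1 at and below the
  -- heir of the parent of c (and just 1 everywhere if c is the root).
  increment : Fin order → Fin order → Carrier
  increment c w = ind (c Fin.≟ w) + - (ind (¬? (c Fin.≟ root)) * ind (heir (par c) Fin.≟ w))

  ⟶-heir-sibling : ∀ {c u} → c ≢ root → u ⟶ heir (par c) → u ⟶ c
  ⟶-heir-sibling {c} c≢root u⟶h = ≡.subst (_⟶ c) (⟶-unique (⟶heir (par⟶ c≢root)) u⟶h) (par⟶ c≢root)

  ⟶-sibling-heir : ∀ {c u} → u ⟶ c → u ⟶ heir (par c)
  ⟶-sibling-heir {c} {u} u⟶c = ≡.subst (λ p → u ⟶ heir p) (≡.sym (⟶⇒par≡ u⟶c)) (⟶heir u⟶c)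

  -- `c` and the heir of its parent are siblings: both or neither are children of `u`, and their
  -- contributions cancel. The root is nobody's child.
  increment-sumsToZero : ∀ c → SumsToZero (increment c)
  increment-sumsToZero c u = begin
    down (increment c) u
      ≈⟨ down-+ (λ w → ind (c Fin.≟ w)) _ u ⟩
    down (λ w → ind (c Fin.≟ w)) u + down (λ w → - (i * ind (h Fin.≟ w))) u
      ≈⟨ +-cong (select c) (trans (down-cong u λ _ → trans (-‿distribˡ-* i _) (*-comm _ _))
           (trans (weighted-*ʳ (λ w → ind (u ⟶? w)) (λ w → ind (h Fin.≟ w)) (- i)) (*-congʳ (select h)))) ⟩
    ind (u ⟶? c) + ind (u ⟶? h) * - i
      ≈⟨ +-congˡ (sym (-‿distribʳ-* _ i)) ⟩
    ind (u ⟶? c) + - (ind (u ⟶? h) * i)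
      ≈⟨ +-congˡ (-‿cong (same (c Fin.≟ root))) ⟩
    ind (u ⟶? c) + - ind (u ⟶? c)
      ≈⟨ -‿inverseʳ _ ⟩
    0# ∎
    where
    h : Fin order
    h = heir (par c)
    i : Carrier
    i = ind (¬? (c Fin.≟ root))
    select : ∀ a → down (λ w → ind (a Fin.≟ w)) u ≈ ind (u ⟶? a)
    select a = trans (sum-cong-≋ λ w → *-comm (ind (u ⟶? w)) (ind (a Fin.≟ w)))
      (sum-only (a Fin.≟_) (λ w → ind (u ⟶? w)) ≡.refl λ _ → ≡.sym)
    same : (c≟root : Dec (c ≡ root)) → ind (u ⟶? h) * ind (¬? c≟root) ≈ ind (u ⟶? c)
    same (yes ≡.refl) = trans (zeroʳ _) (sym (ind-false (u ⟶? root) ¬⟶root))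
    same (no c≢root)  = trans (*-identityʳ _)
      (ind-⇔ (u ⟶? h) (u ⟶? c) (⟶-heir-sibling c≢root) ⟶-sibling-heir)

  -- The correction term is supported on an heir. On non-heirs the increments are therefore unit
  -- vectors, which is how coefficients are read off.
  increment-nonHeir : ∀ c {w} → ¬ Heir w → increment c w ≈ ind (c Fin.≟ w)
  increment-nonHeir c {w} ¬heir = trans
    (+-congˡ (trans (-‿cong (vanish (c Fin.≟ root))) -0#≈0#)) (+-identityʳ _)
    where
    vanish : (c≟root : Dec (c ≡ root)) → ind (¬? c≟root) * ind (heir (par c) Fin.≟ w) ≈ 0#
    vanish (yes _)     = zeroˡ _
    vanish (no c≢root) = *≈0ʳ _ (ind-false (heir (par c) Fin.≟ w) λ h≡w → ¬heir (≡.trans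
      (≡.cong heir (⟶⇒par≡ (≡.subst (par c ⟶_) h≡w (⟶heir (par⟶ c≢root))))) h≡w))

  index-heir : ∀ {c} → c ≢ root → index (heir (par c)) ≡ index c
  index-heir c≢root = ℕ.suc-injective
    (≡.trans (≡.sym (index-⟶ (⟶heir (par⟶ c≢root)))) (index-⟶ (par⟶ c≢root)))

  -- The increment lives on `c` and on a vertex of the same index. With `φ = F x ∘ suc` this yields
  -- `gap` for the basis vectors.
  increment-vanishes : ∀ (φ : ℕ → Carrier) {c} → φ (index c) ≈ 0# → ∀ w → increment c w * φ (index w) ≈ 0#
  increment-vanishes φ {c} φ≈0 w = trans (distribʳ _ _ _) (+≈0
    (trans (ind-cong (c Fin.≟ w) λ { ≡.refl → φ≈0 }) (zeroʳ _))
    (trans (sym (-‿distribˡ-* _ _)) (trans (-‿cong (vanish (c Fin.≟ root))) -0#≈0#)))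
    where
    vanish : (c≟root : Dec (c ≡ root)) → ind (¬? c≟root) * ind (heir (par c) Fin.≟ w) * φ (index w) ≈ 0#
    vanish (yes _)     = *≈0ˡ _ (zeroˡ _)
    vanish (no c≢root) = trans (*-congʳ (*-identityˡ _)) (trans
      (ind-cong (heir (par c) Fin.≟ w) λ { ≡.refl → trans (reflexive (≡.cong φ (index-heir c≢root))) φ≈0 })
      (zeroʳ _))

  -- Siblings other than the heir are not heirs, so the value at the heir is
  -- determined by the others.
  sumsToZero-determined : ∀ {δ δ′} → SumsToZero δ → SumsToZero δ′ →
    (∀ {w} → ¬ Heir w → δ w ≈ δ′ w) → ∀ w → δ w ≈ δ′ w
  sumsToZero-determined {δ} {δ′} δ≈0 δ′≈0 agree w with heir? w
  ... | no ¬heir  = agree ¬heir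
  ... | yes heir-w = +-cancelʳ (others δ) _ _ (begin
    δ w + others δ    ≈⟨ split δ ⟨
    down δ p          ≈⟨ trans (δ≈0 p) (sym (δ′≈0 p)) ⟩
    down δ′ p         ≈⟨ split δ′ ⟩
    δ′ w + others δ′  ≈⟨ +-congˡ (sum-cong-≋ λ v → ind-cong ((p ⟶? v) ×-dec ¬? (v Fin.≟ w)) λ (p⟶v , v≢w) →
                           agree λ heir-v → v≢w (≡.trans (≡.sym heir-v)
                             (≡.trans (≡.cong heir (⟶⇒par≡ p⟶v)) heir-w))) ⟨
    δ′ w + others δ   ∎)
    where
    p : Fin order
    p = par w
    p⟶w : p ⟶ w
    p⟶w = par⟶ λ { ≡.refl → ¬Heir-root heir-w }
    others : (Fin order → Carrier) → Carrier
    others g = sum λ v → ind ((p ⟶? v) ×-dec ¬? (v Fin.≟ w)) * g v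
    split : ∀ g → down g p ≈ g w + others g
    split g = trans (sum-cong-≋ λ v → trans (*-congʳ (trans (ind-split (p ⟶? v) (v Fin.≟ w)) (+-congʳ
        (ind-⇔ ((p ⟶? v) ×-dec (v Fin.≟ w)) (v Fin.≟ w) proj₂ λ { ≡.refl → p⟶w , ≡.refl }))))
        (distribʳ (g v) _ _))
      (trans (∑-distrib-+ (λ v → ind (v Fin.≟ w) * g v) _) (+-congʳ (sum-only (Fin._≟ w) g ≡.refl λ _ → id)))

  module Basis (x : Carrier) where
    BasisVertex : Fin order → Set ℓ
    BasisVertex v = ¬ Heir v × F x (suc (index v)) ≈ 0#

    basisVertex? : Decidable BasisVertex
    basisVertex? v = ¬? (heir? v) ×-dec (F x (suc (index v)) ≟ 0#)

    open Enumerations commutativeSemiring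
    open Enumeration (enumerate basisVertex?) public

    δ L b : Fin size → Fin order → Carrier
    δ j   = increment (at j)
    L j   = lift (δ j)
    b j u = L j u * F x (index u)

    combine : (Fin size → Carrier) → (Fin size → Fin order → Carrier) → Fin order → Carrier
    combine c g u = sum λ j → c j * g j u

    weighted-combine : ∀ (a : Fin order → Carrier) c g →
      sum (λ w → a w * combine c g w) ≈ sum (λ j → c j * sum (λ w → a w * g j w))
    weighted-combine a c g = begin
      sum (λ w → a w * combine c g w)
        ≈⟨ sum-cong-≋ (λ w → trans (sym (sum-*ˡ (a w) λ j → c j * g j w))
             (sum-cong-≋ λ j → swap (a w) (c j) (g j w))) ⟩
      sum (λ w → sum λ j → c j * (a w * g j w))
        ≈⟨ ∑-comm (λ w j → c j * (a w * g j w)) ⟩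
      sum (λ j → sum λ w → c j * (a w * g j w))
        ≈⟨ sum-cong-≋ (λ j → sum-*ˡ (c j) λ w → a w * g j w) ⟩
      sum (λ j → c j * sum (λ w → a w * g j w)) ∎
      where
      swap : ∀ a c g → a * (c * g) ≈ c * (a * g)
      swap = solve 3 (λ a c g → a :* (c :* g) := c :* (a :* g)) refl

    combine-lift : ∀ c u → combine c L u ≈ combine c δ u + up (combine c L) u
    combine-lift c u = begin
      sum (λ j → c j * L j u)
        ≈⟨ sum-cong-≋ (λ j → trans (*-congˡ (lift-up (δ j) u)) (distribˡ (c j) _ _)) ⟩
      sum (λ j → c j * δ j u + c j * up (L j) u)
        ≈⟨ ∑-distrib-+ (λ j → c j * δ j u) _ ⟩
      combine c δ u + sum (λ j → c j * up (L j) u)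
        ≈⟨ +-congˡ (weighted-combine (λ w → ind (w ⟶? u)) c L) ⟨
      combine c δ u + up (combine c L) u ∎

    combine-sumsToZero : ∀ c → SumsToZero (combine c δ)
    combine-sumsToZero c u = trans (weighted-combine (λ w → ind (u ⟶? w)) c δ)
      (sum-zero _ λ j → *≈0ʳ (c j) (increment-sumsToZero (at j) u))

    combine-coherent : ∀ c → Coherent (combine c L)
    combine-coherent c = sumsToZero⇒coherent (combine-lift c) (combine-sumsToZero c)

    linearCombination≈ : ∀ c u → linearCombination c b u ≈ combine c L u * F x (index u)
    linearCombination≈ c u = weighted-*ʳ c (λ j → L j u) (F x (index u))

    combine-nonHeir : ∀ c {w} → ¬ Heir w → combine c δ w ≈ sum λ j → ind (at j Fin.≟ w) * c j
    combine-nonHeir c ¬heir = sum-cong-≋ λ j → trans (*-congˡ (increment-nonHeir (at j) ¬heir)) (*-comm _ _)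

    member : ∀ j → Eigenspace (A[_] graph α) x (b j)
    member j = represents⇒eigen x {t = L j} record
      { v≈tF     = λ _ → refl
      ; gap      = λ u → sym (trans (*-congʳ (lift-up (δ j) u)) (trans (distribʳ _ _ _)
                     (trans (+-congʳ (increment-vanishes (F x ∘ suc) (proj₂ (at∈ j)) u)) (+-identityˡ _))))
      ; coherent = sumsToZero⇒coherent (lift-up (δ j)) (increment-sumsToZero (at j))
      }

    -- The combined `t` is coherent, so it vanishes with the eigenvector, and its increments vanish
    -- as well. At the non-heir `at j` the combined increment is `c j`.
    independent : ∀ c → (∀ u → linearCombination c b u ≈ 0#) → ∀ j → c j ≈ 0#
    independent c lc≈0 j = begin
      c j
        ≈⟨ sum-only (λ i → at i Fin.≟ at j) c ≡.refl (λ _ → injective) ⟨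
      sum (λ i → ind (at i Fin.≟ at j) * c i)
        ≈⟨ combine-nonHeir c (proj₁ (at∈ j)) ⟨
      combine c δ (at j)
        ≈⟨ +-identityʳ _ ⟨
      combine c δ (at j) + 0#
        ≈⟨ +-congˡ (trans (up-cong (at j) λ {p} _ → t≈0 p) (zeroes (at j))) ⟨
      combine c δ (at j) + up (combine c L) (at j)
        ≈⟨ combine-lift c (at j) ⟨
      combine c L (at j)
        ≈⟨ t≈0 (at j) ⟩
      0# ∎
      where
      zeroes : ∀ u → up (λ _ → 0#) u ≈ 0#
      zeroes u = sum-zero (λ w → ind (w ⟶? u) * 0#) λ w → zeroʳ (ind (w ⟶? u))
      t≈0 : ∀ u → combine c L u ≈ 0#
      t≈0 = coherent-zero x (combine-coherent c) λ u → trans (sym (linearCombination≈ c u)) (lc≈0 u)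

    -- The coefficients are the increments `γ` of `t` at the basis vertices. At any other non-heir
    -- `F x (suc (index u))` is nonzero, and `gap` forces `γ` to vanish; the heirs then follow from
    -- the zero sums, and `t` from its increments.
    spanning : ∀ v → Eigenspace (A[_] graph α) x v → ∃ λ c → ∀ u → v u ≈ linearCombination c b u
    spanning v v-eigen = c , λ u → trans (v≈tF u) (trans (*-congʳ (t≈combine u)) (sym (linearCombination≈ c u)))
      where
      open Represents (eigen⇒represents x v-eigen)
      s γ : Fin order → Carrier
      s = t x v-eigen
      γ u = s u + - up s u
      s≈ : ∀ u → s u ≈ γ u + up s u
      s≈ u = sym (y-x+x≈y (up s u) (s u))
      γF≈0 : ∀ u → γ u * F x (suc (index u)) ≈ 0#
      γF≈0 u = trans (distribʳ _ _ _) (trans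
        (+-congˡ (trans (sym (-‿distribˡ-* _ _)) (-‿cong (gap u)))) (-‿inverseʳ _))
      c : Fin size → Carrier
      c = γ ∘ at
      nonHeir : ∀ {w} → ¬ Heir w → γ w ≈ combine c δ w
      nonHeir {w} ¬heir = begin
        γ w
          ≈⟨ basis-only ⟨
        ind (basisVertex? w) * γ w
          ≈⟨ sum-only (Fin._≟ w) (λ v → ind (basisVertex? v) * γ v) ≡.refl (λ _ → id) ⟨
        sum (λ v → ind (v Fin.≟ w) * (ind (basisVertex? v) * γ v))
          ≈⟨ sum-cong-≋ (λ v → solve 3 (λ i j g → i :* (j :* g) := j :* (i :* g)) refl
               (ind (v Fin.≟ w)) (ind (basisVertex? v)) (γ v)) ⟩
        sum (λ v → ind (basisVertex? v) * (ind (v Fin.≟ w) * γ v))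
          ≈⟨ sum-at (λ v → ind (v Fin.≟ w) * γ v) ⟨
        sum (λ j → ind (at j Fin.≟ w) * c j)
          ≈⟨ combine-nonHeir c ¬heir ⟨
        combine c δ w ∎
        where
        basis-only : ind (basisVertex? w) * γ w ≈ γ w
        basis-only = decide (F x (suc (index w)) ≟ 0#)
          where
          decide : Dec (F x (suc (index w)) ≈ 0#) → ind (basisVertex? w) * γ w ≈ γ w
          decide (yes F≈0) = trans (*-congʳ (ind-true (basisVertex? w) (¬heir , F≈0))) (*-identityˡ _)
          decide (no  F≉0) = trans (*≈0ʳ _ γ≈0) (sym γ≈0)
            where
            γ≈0 : γ w ≈ 0#
            γ≈0 = *≈0⇒≈0 F≉0 (trans (*-comm _ _) (γF≈0 w))
      γ≈combine : ∀ w → γ w ≈ combine c δ w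
      γ≈combine = sumsToZero-determined (coherent⇒sumsToZero s≈ coherent) (combine-sumsToZero c) nonHeir
      t≈combine : ∀ u → s u ≈ combine c L u
      t≈combine = lift-unique λ u → begin
        s u + up (combine c L) u                ≈⟨ +-congʳ (trans (s≈ u) (+-congʳ (γ≈combine u))) ⟩
        combine c δ u + up s u + up (combine c L) u
          ≈⟨ solve 3 (λ a b c → a :+ b :+ c := a :+ c :+ b) refl (combine c δ u) (up s u) _ ⟩
        combine c δ u + up (combine c L) u + up s u  ≈⟨ +-congʳ (combine-lift c u) ⟨
        combine c L u + up s u                  ∎

    hasMultiplicity : HasMultiplicity (A[_] graph α) x size
    hasMultiplicity = b , record { member = member ; independent = independent ; spanning = spanning }

-- Comparison of the two spectra.

module SpectrumOfA {ℓ} (R : Reals ℓ) {k} (2≤k : 2 ℕ.≤ k) (B : GeneralizedBetheTree k)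
  (α : Reals.Carrier R) (0≤α : Reals._≤_ R (Reals.0# R) α) (α<1 : Reals._<_ R α (Reals.1# R)) where
  open Reals R hiding (zero)
  open Spectral R hiding (β)
  open SquareRoot R using (√_; sqrt; fromℕ-nonneg)
  open OrderedField R
  open FiniteSum commutativeSemiring
  open GeneralizedBetheTree B
  open BetheTree 2≤k B
  open TreeEigenspace R 2≤k B α α<1
  open ThreeTerm R β 0<β D μ using (f; largest-root; module Symmetric)

  b r : ℕ → Carrier
  b s = offDiagonal B α s
  r s = √ (children s)

  b≈βr : ∀ s → b s ≈ β * r s
  b≈βr s = go (does (s ℕ.≟ k))
    where
    go : ∀ s≡k → (if s≡k then β * √ (d s) else β * √ (d s ∸ 1)) ≈ β * √ (if s≡k then d s else d s ∸ 1)
    go true  = refl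
    go false = refl

  0≤√ : ∀ m → 0# ≤ √ m
  0≤√ m = proj₁ (proj₂ (sqrt (fromℕ m) (fromℕ-nonneg m)))

  r*r≈μ : ∀ s → r s * r s ≈ μ s
  r*r≈μ s = proj₂ (proj₂ (sqrt (fromℕ (children s)) (fromℕ-nonneg (children s))))

  0<μ : ∀ i → 1 ℕ.≤ i → i ℕ.< k → 0# < μ (suc i)
  0<μ i 1≤i i<k = 0<fromℕ (1≤children i 1≤i i<k)

  0<r : ∀ i → 1 ℕ.≤ i → i ℕ.< k → 0# < r (suc i)
  0<r i 1≤i i<k = 0≤√ (children (suc i)) , λ 0≈r → 0<⇒≉0 (0<μ i 1≤i i<k)
    (trans (sym (r*r≈μ (suc i))) (*≈0ˡ _ (sym 0≈r)))

  open Tridiagonal R D b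
  open Symmetric b r k b≈βr r*r≈μ 0<r
    using (0<g; eigenvector; eigenvector∈Eigenspace; multiplicity-zero; multiplicity-one)

  -- The three conditions exclude one another, so the nested conditionals amount to a sum.
  entry≈tridiagonal : ∀ s t → entry B α s t ≈ tridiagonal s t
  entry≈tridiagonal s t = trans
    (select (s ℕ.≟ t) λ { ≡.refl → trans (select (suc s ℕ.≟ s) λ eq → ⊥-elim (ℕ.1+n≢n eq))
      (+≈0 (*≈0ˡ _ (ind-false (suc s ℕ.≟ s) ℕ.1+n≢n))
           (trans (if≈ind (s ℕ.≟ suc s) _) (*≈0ˡ _ (ind-false (s ℕ.≟ suc s) (ℕ.1+n≢n ∘ ≡.sym))))) })
    (+-congˡ (trans
      (select (suc s ℕ.≟ t) λ { ≡.refl → trans (if≈ind (s ℕ.≟ suc (suc s)) _)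
        (*≈0ˡ _ (ind-false (s ℕ.≟ suc (suc s)) λ eq →
          ℕ.m≢1+m+n s (≡.trans eq (≡.cong suc (≡.sym (ℕ.+-comm s 1)))))) })
      (+-congˡ (if≈ind (s ℕ.≟ suc t) _))))
    where
    select : ∀ {p} {P : Set p} (P? : Dec P) {a y} → (P → y ≈ 0#) →
             (if does P? then a else y) ≈ ind P? * a + y
    select (yes p) y≈0 = sym (trans (+-cong (*-identityˡ _) (y≈0 p)) (+-identityʳ _))
    select (no _)  _   = sym (trans (+-congʳ (zeroˡ _)) (+-identityˡ _))

  T-tridiagonal : IsTridiagonal (T B α)
  T-tridiagonal p q = entry≈tridiagonal (suc (toℕ p)) (suc (toℕ q))

  leading-tridiagonal : ∀ {j} (j≤k : j ℕ.≤ k) → IsTridiagonal (leading j≤k (T B α))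
  leading-tridiagonal j≤k p q = trans
    (reflexive (≡.cong₂ (λ s t → entry B α (suc s) (suc t)) (Fin.toℕ-inject≤ p j≤k) (Fin.toℕ-inject≤ q j≤k)))
    (entry≈tridiagonal (suc (toℕ p)) (suc (toℕ q)))

  module _ (x : Carrier) where
    root? : ∀ j → Dec (f x (suc j) ≈ 0#)
    root? j = f x (suc j) ≟ 0#

    leading-multiplicity : ∀ {j m} → 1 ℕ.≤ j → (j≤k : j ℕ.≤ k) →
      HasMultiplicity (leading j≤k (T B α)) x m → m ≡ ℕ-Sum.ind (root? j)
    leading-multiplicity {suc j} 1≤j j≤k mult with root? (suc j)
    ... | yes f≈0 = multiplicity-one x _ (leading-tridiagonal j≤k) j≤k f≈0 mult
    ... | no  f≉0 = multiplicity-zero x _ (leading-tridiagonal j≤k) j≤k f≉0 mult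

  ⨄-cong : ∀ {σ τ : ℕ → Multiset} x m → (∀ j → 1 ℕ.≤ j → j ℕ.≤ m → σ j x ≡ τ j x) → ⨄ m σ x ≡ ⨄ m τ x
  ⨄-cong x zero    eq = ≡.refl
  ⨄-cong x (suc m) eq = ≡.cong₂ ℕ._+_ (⨄-cong x m λ j 1≤j j≤m → eq j 1≤j (ℕ.m≤n⇒m≤1+n j≤m))
                                      (eq (suc m) (s≤s z≤n) ℕ.≤-refl)

  -- Regroups a sum over levels as a sum over vertices. The cut-off `index v ≤ m` is there for the
  -- induction on `m`, which adds one level at a time.
  nonHeirs-⨄ : ∀ (σ : ℕ → Multiset) x m → ⨄ m (λ j → nonHeirs j ⊗ σ j) x ≡
    ℕ-Sum.sum (λ v → ℕ-Sum.ind (index v ℕ.≤? m) ℕ.* (ℕ-Sum.ind (¬? (heir? v)) ℕ.* σ (index v) x))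
  nonHeirs-⨄ σ x zero = ≡.sym (ℕ-Sum.sum-none (λ v → index v ℕ.≤? 0) _ λ v → ℕ.<⇒≱ (0<index v))
  nonHeirs-⨄ σ x (suc m) = begin
    ⨄ m (λ j → nonHeirs j ⊗ σ j) x ℕ.+ nonHeirs (suc m) ℕ.* σ (suc m) x
      ≡⟨ ≡.cong₂ ℕ._+_ (nonHeirs-⨄ σ x m) last-level ⟩
    Σ.sum (λ v → Σ.ind (index v ℕ.≤? m) ℕ.* weight v) ℕ.+ Σ.sum (λ v → Σ.ind (index v ℕ.≟ suc m) ℕ.* weight v)
      ≡⟨ Σ.∑-distrib-+ (λ v → Σ.ind (index v ℕ.≤? m) ℕ.* weight v) _ ⟨
    Σ.sum (λ v → Σ.ind (index v ℕ.≤? m) ℕ.* weight v ℕ.+ Σ.ind (index v ℕ.≟ suc m) ℕ.* weight v)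
      ≡⟨ Σ.sum-cong-≋ (λ v → ≡.trans (≡.sym (ℕ.*-distribʳ-+ (weight v) (Σ.ind (index v ℕ.≤? m)) _))
           (≡.cong (ℕ._* weight v) (ind-≤ (index v)))) ⟩
    Σ.sum (λ v → Σ.ind (index v ℕ.≤? suc m) ℕ.* weight v) ∎
    where
    open ≡-Reasoning
    module Σ = ℕ-Sum
    weight : Fin order → ℕ
    weight v = Σ.ind (¬? (heir? v)) ℕ.* σ (index v) x
    last-level : nonHeirs (suc m) ℕ.* σ (suc m) x ≡ Σ.sum (λ v → Σ.ind (index v ℕ.≟ suc m) ℕ.* weight v)
    last-level = ≡.trans
      (≡.sym (Σ.sum-*ʳ (λ v → Σ.ind ((index v ℕ.≟ suc m) ×-dec ¬? (heir? v))) (σ (suc m) x)))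
      (Σ.sum-cong-≋ λ v →
      ≡.trans (≡.cong (ℕ._* σ (suc m) x) (Σ.ind-* (index v ℕ.≟ suc m) (¬? (heir? v))))
      (≡.trans (ℕ.*-assoc (Σ.ind (index v ℕ.≟ suc m)) _ _)
        (Σ.ind-cong (index v ℕ.≟ suc m) λ eq → ≡.cong (λ i → Σ.ind (¬? (heir? v)) ℕ.* σ i x) (≡.sym eq))))
    ind-≤ : ∀ i → Σ.ind (i ℕ.≤? m) ℕ.+ Σ.ind (i ℕ.≟ suc m) ≡ Σ.ind (i ℕ.≤? suc m)
    ind-≤ i with ℕ.<-cmp i (suc m)
    ... | tri< i<1+m i≢ _ = ≡.trans
      (≡.cong₂ ℕ._+_ (Σ.ind-true (i ℕ.≤? m) (ℕ.≤-pred i<1+m)) (Σ.ind-false (i ℕ.≟ suc m) i≢))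
      (≡.sym (Σ.ind-true (i ℕ.≤? suc m) (ℕ.<⇒≤ i<1+m)))
    ... | tri≈ ¬i<1+m i≡ _ = ≡.trans
      (≡.cong₂ ℕ._+_ (Σ.ind-false (i ℕ.≤? m) (¬i<1+m ∘ s≤s)) (Σ.ind-true (i ℕ.≟ suc m) i≡))
      (≡.sym (Σ.ind-true (i ℕ.≤? suc m) (ℕ.≤-reflexive i≡)))
    ... | tri> ¬i<1+m i≢ i>1+m = ≡.trans
      (≡.cong₂ ℕ._+_ (Σ.ind-false (i ℕ.≤? m) (¬i<1+m ∘ s≤s)) (Σ.ind-false (i ℕ.≟ suc m) i≢))
      (≡.sym (Σ.ind-false (i ℕ.≤? suc m) (ℕ.<⇒≱ i>1+m)))

  ⨄-pred : ∀ (σ : ℕ → Multiset) x → ⨄ (k ∸ 1) σ x ℕ.+ σ k x ≡ ⨄ k σ x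
  ⨄-pred σ x = go k (ℕ.≤-trans (s≤s z≤n) 2≤k)
    where
    go : ∀ k → 1 ℕ.≤ k → ⨄ (k ∸ 1) σ x ℕ.+ σ k x ≡ ⨄ k σ x
    go (suc k) _ = ≡.refl

  -- A non-heir `v` is a basis vertex exactly when `x` is an eigenvalue of T_j for `j = index v`,
  -- that is, it contributes `σ (index v) x` to the size of the basis. Grouping by index gives the
  -- union.
  spectrum : ∀ (σ : ℕ → Multiset) →
    (∀ j → 1 ℕ.≤ j → (j≤k : j ℕ.≤ k) → IsSpectrum (leading j≤k (T B α)) (σ j)) →
    IsSpectrum (A[_] graph α) (⨄ (k ∸ 1) (λ j → (n j ∸ n (suc j)) ⊗ σ j) ⊎ σ k)
  spectrum σ σ-spectrum x = ≡.subst (HasMultiplicity (A[_] graph α) x) size≡total hasMultiplicity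
    where
    open Basis x using (size; size≡; hasMultiplicity; basisVertex?)
    open ≡-Reasoning
    module Σ = ℕ-Sum
    σ≡ind : ∀ v → σ (index v) x ≡ Σ.ind (root? x (index v))
    σ≡ind v = leading-multiplicity x (0<index v) (index≤k v) (σ-spectrum _ (0<index v) (index≤k v) x)
    size≡total : size ≡ ⨄ (k ∸ 1) (λ j → (n j ∸ n (suc j)) ⊗ σ j) x ℕ.+ σ k x
    size≡total = begin
      size
        ≡⟨ size≡ ⟩
      Σ.sum (Σ.ind ∘ basisVertex?)
        ≡⟨ Σ.sum-cong-≋ (λ v → begin
             Σ.ind (basisVertex? v)
               ≡⟨ Σ.ind-* (¬? (heir? v)) (root? x (index v)) ⟩
             Σ.ind (¬? (heir? v)) ℕ.* Σ.ind (root? x (index v))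
               ≡⟨ ≡.cong (Σ.ind (¬? (heir? v)) ℕ.*_) (σ≡ind v) ⟨
             Σ.ind (¬? (heir? v)) ℕ.* σ (index v) x
               ≡⟨ ℕ.*-identityˡ _ ⟨
             1 ℕ.* (Σ.ind (¬? (heir? v)) ℕ.* σ (index v) x)
               ≡⟨ ≡.cong (ℕ._* (Σ.ind (¬? (heir? v)) ℕ.* σ (index v) x))
                    (Σ.ind-true (index v ℕ.≤? k) (index≤k v)) ⟨
             Σ.ind (index v ℕ.≤? k) ℕ.* (Σ.ind (¬? (heir? v)) ℕ.* σ (index v) x) ∎) ⟩
      Σ.sum (λ v → Σ.ind (index v ℕ.≤? k) ℕ.* (Σ.ind (¬? (heir? v)) ℕ.* σ (index v) x))
        ≡⟨ nonHeirs-⨄ σ x k ⟨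
      ⨄ k (λ j → nonHeirs j ⊗ σ j) x
        ≡⟨ ⨄-pred (λ j → nonHeirs j ⊗ σ j) x ⟨
      ⨄ (k ∸ 1) (λ j → nonHeirs j ⊗ σ j) x ℕ.+ nonHeirs k ℕ.* σ k x
        ≡⟨ ≡.cong₂ ℕ._+_
             (⨄-cong x (k ∸ 1) λ j 1≤j j≤k-1 → ≡.cong (ℕ._* σ j x) (≡.sym (n∸n≡nonHeirs j 1≤j (<k j≤k-1))))
             (≡.trans (≡.cong (ℕ._* σ k x) nonHeirs-k) (ℕ.*-identityˡ _)) ⟩
      ⨄ (k ∸ 1) (λ j → (n j ∸ n (suc j)) ⊗ σ j) x ℕ.+ σ k x ∎
      where
      <k : ∀ {j} → j ℕ.≤ k ∸ 1 → j ℕ.< k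
      <k j≤k-1 = ℕ.≤-trans (s≤s j≤k-1) (ℕ.≤-reflexive (ℕ.m+[n∸m]≡n (ℕ.≤-trans (s≤s z≤n) 2≤k)))

  0≤ind : ∀ {p} {P : Set p} (P? : Dec P) → 0# ≤ ind P?
  0≤ind (yes _) = 0≤1
  0≤ind (no _)  = ≤-refl

  A-nonneg : ∀ u v → 0# ≤ A[_] graph α u v
  A-nonneg u v = +-nonneg
    (*-nonneg 0≤α (≤-respʳ-≈ (sym (if≈ind (u Fin.≟ v) _))
      (*-nonneg (0≤ind (u Fin.≟ v)) (fromℕ-nonneg (degree u)))))
    (*-nonneg (proj₁ 0<β) (0≤ind (u ~? v)))

  tridiagonal-nonneg : ∀ s t → 0# ≤ tridiagonal s t
  tridiagonal-nonneg s t = +-nonneg (*-nonneg (0≤ind (s ℕ.≟ t)) 0≤D)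
    (+-nonneg (*-nonneg (0≤ind (suc s ℕ.≟ t)) (0≤b t)) (*-nonneg (0≤ind (s ℕ.≟ suc t)) (0≤b s)))
    where
    0≤D : 0# ≤ D s
    0≤D = ≤-respʳ-≈ (sym (diagonal≈ s)) (*-nonneg 0≤α (fromℕ-nonneg (d s)))
    0≤b : ∀ s → 0# ≤ b s
    0≤b s = ≤-respʳ-≈ (sym (b≈βr s)) (*-nonneg (proj₁ 0<β) (0≤√ (children s)))

  T-nonneg : ∀ p q → 0# ≤ T B α p q
  T-nonneg p q = ≤-respʳ-≈ (sym (T-tridiagonal p q)) (tridiagonal-nonneg (suc (toℕ p)) (suc (toℕ q)))

  open PositiveEigenvector R

  module _ {ρ} (f>0 : ∀ i → i ℕ.< k → 0# < f ρ (suc i)) (f≈0 : f ρ (suc k) ≈ 0#) where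
    -- The size is a variable of its own, equal to `k`, so that it can be split as a successor; `k`
    -- itself is fixed. Positivity of `g` and `f` makes the eigenvector positive.
    T-largest : ∀ {j} → j ≡ k → (M : Matrix j j) → IsTridiagonal M → (∀ p q → 0# ≤ M p q) →
                IsLargestEigenvalue M ρ
    T-largest {zero}  ≡.refl M tri M≥0 = ⊥-elim (ℕ.<⇒≱ 2≤k z≤n)
    T-largest {suc j} ≡.refl M tri M≥0 = largestEigenvalue M M≥0 {w = eigenvector ρ M tri ℕ.≤-refl}
      (λ p → 0<* (0<g (toℕ p) (Fin.toℕ<n p)) (f>0 (toℕ p) (Fin.toℕ<n p)))
      (eigenvector∈Eigenspace ρ M tri ℕ.≤-refl f≈0) zero

    radial : Fin order → Carrier
    radial u = f ρ (index u)

    -- A constant `t` is coherent and has no increment below the root. At the root its increment is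
    -- 1, which is allowed because `f ρ (suc k)` vanishes.
    radial-represents : Represents ρ radial (λ _ → 1#)
    radial-represents = record
      { v≈tF     = λ u → sym (*-identityˡ _)
      ; gap      = gap
      ; coherent = λ u → down-const u 1#
      }
      where
      gap : ∀ u → up (λ _ → 1#) u * f ρ (suc (index u)) ≈ 1# * f ρ (suc (index u))
      gap u with u Fin.≟ root
      ... | yes ≡.refl = trans (*≈0ʳ _ f[1+root]≈0) (sym (*≈0ʳ _ f[1+root]≈0))
        where
        f[1+root]≈0 : f ρ (suc (index root)) ≈ 0#
        f[1+root]≈0 = trans (reflexive (≡.cong (f ρ ∘ suc) index-root)) f≈0
      ... | no u≢root = *-congʳ (up-child (λ _ → 1#) (par⟶ u≢root))

    A-largest : IsLargestEigenvalue (A[_] graph α) ρ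
    A-largest = largestEigenvalue (A[_] graph α) A-nonneg {w = radial}
      (λ u → ≡.subst (λ i → 0# < f ρ i) (≡.sym (index-predecessor u))
        (f>0 _ (≡.subst (ℕ._≤ k) (index-predecessor u) (index≤k u))))
      (represents⇒eigen ρ radial-represents) root

  largest : ∃ λ ρ → IsLargestEigenvalue (T B α) ρ × IsLargestEigenvalue (A[_] graph α) ρ
  largest = from-root (largest-root (λ s → fromℕ-nonneg (children s)) k (ℕ.≤-trans (s≤s z≤n) 2≤k) 0<μ)
    where
    from-root : (∃ λ ρ → (∀ i → i ℕ.< k → 0# < f ρ (suc i)) × f ρ (suc k) ≈ 0#) →
                ∃ λ ρ → IsLargestEigenvalue (T B α) ρ × IsLargestEigenvalue (A[_] graph α) ρ
    from-root (ρ , f>0 , f≈0) =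
      ρ , T-largest f>0 f≈0 ≡.refl (T B α) T-tridiagonal T-nonneg , A-largest f>0 f≈0

theorem6 :
  ∀ {ℓ} (R : Reals ℓ) →
  let open Reals R
      open Spectral R
  in
  ∀ {k} → 2 ℕ.≤ k → (B : GeneralizedBetheTree k) →
  let open GeneralizedBetheTree B in
  ∀ α → 0# ≤ α → α < 1# →
    (∀ (σ : ℕ → Multiset) →
       (∀ j → 1 ℕ.≤ j → (j≤k : j ℕ.≤ k) → IsSpectrum (leading j≤k (T B α)) (σ j)) →
       IsSpectrum (A[_] graph α) (⨄ (k ∸ 1) (λ j → (n j ∸ n (suc j)) ⊗ σ j) ⊎ σ k))
    ×
    (∃ λ ρ → IsLargestEigenvalue (T B α) ρ × IsLargestEigenvalue (A[_] graph α) ρ)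
theorem6 R 2≤k B α 0≤α α<1 = spectrum , largest
  where open SpectrumOfA R 2≤k B α 0≤α α<1
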